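{- Let $(M_{n,2}(x))_{n\ge0}$ and $(\widetilde M_{n,2}(x))_{n\ge0}$ be defined by $M_{0,2}(x)=1$, $\widetilde M_{0,2}(x)=1$ and, for $n\ge1$, $$M_{n,2}(x)=\bigl[(2n-2)x+1\bigr]M_{n-1,2}(x)+2x(1-x)\frac{d}{dx}M_{n-1,2}(x),$$ $$\widetilde M_{n,2}(x)=(2n-1)x\,\widetilde M_{n-1,2}(x)+2x(1-x)\frac{d}{dx}\widetilde M_{n-1,2}(x)$$ (so $M_{1,2}=1$, $M_{2,2}=1+2x$, $\widetilde M_{1,2}=x$), and let $T_{n,2}(x)$ be the polynomial defined by $(1+x)T_{n,2}(x)=xM_{n,2}(x^2)+\widetilde M_{n,2}(x^2)$. Let $(a,b)$ be the $\mathcal{I}_n$-decomposition of $\widetilde M_{n,2}(x)$. Then $T_{n,2}(x)$ is Hurwitz stable for all $n\in\mathbb{N}$ and $b\ll a$. In particular, $M_{n,2}(x)$ and $\widetilde M_{n,2}(x)$ are alternatingly increasing for all $n\in\mathbb{N}$.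
   Context: $M_{n,2}$ and $\widetilde M_{n,2}$ are the interior-peak and left-peak generating polynomials on the dual set of Stirling permutations of order $n$; this is not needed for the statement. A polynomial is Hurwitz stable if it is identically zero or has no zeros with $\Re(x)>0$. For $p$ of degree at most $n$, $\mathcal{I}_n(p)(x)=x^np(1/x)$; the $\mathcal{I}_n$-decomposition of $p$ is the unique pair $(a,b)$ with $p=a+xb$, $\mathcal{I}_n(a)=a$ and $\mathcal{I}_{n-1}(b)=b$. For real-rooted real polynomials $f,g$ with zeros $\{r_i\}$, $\{s_j\}$ in decreasing order, $g\preceq f$ means either $\deg f=\deg g+1=d$ and $r_d\le s_{d-1}\le\cdots\le s_1\le r_1$, or $\deg f=\deg g=d$ and $s_d\le r_d\le\cdots\le s_1\le r_1$; $g\ll f$ means $g\preceq f$ with leading coefficients of the same sign, or $f\preceq g$ with leading coefficients of opposite sign; by convention $0\ll f$ and $f\ll0$ for real-rooted $f$. A polynomial $p=\sum_{j=0}^dp_jx^j$ of degree $d$ is alternatingly increasing if $0\le p_0\le p_d\le p_1\le p_{d-1}\le\cdots\le p_{\lfloor(d+1)/2\rfloor}$. -}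

module Defs where

open import Algebra.Bundles using (CommutativeRing)
import Algebra.Definitions.RawMonoid as RawMonoidDefs
open import Data.Fin.Base using (Fin; zero; suc; toℕ; inject₁)
open import Data.List.Base using (List; []; _∷_; map; foldr; applyUpTo)
open import Data.Nat.Base as ℕ using (ℕ; zero; suc; _∸_)
open import Data.Product.Base using (∃; ∃-syntax; _×_)
open import Data.Sum.Base using (_⊎_)
open import Data.Vec.Functional as Vector using (Vector)
open import Level using (0ℓ)
open import Relation.Binary.Core using (Rel)
open import Relation.Binary.Structures using (IsStrictTotalOrder)
import Relation.Binary.Construct.StrictToNonStrict as ToNonStrict
open import Relation.Binary.PropositionalEquality.Core using (_≡_)
open import Relation.Nullary.Negation.Core using (¬_)

-- The real numbers, given by their axiomatic characterisation: a totally
-- ordered field in which every inhabited subset that is bounded above has a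
-- least upper bound.  The order is trichotomous, as in classical analysis.
record CompleteOrderedField : Set₁ where
  infix 4 _<_
  field
    commutativeRing : CommutativeRing 0ℓ 0ℓ

  open CommutativeRing commutativeRing public
    using (Carrier; _≈_; _+_; _*_; -_; _-_; 0#; 1#)

  field
    _<_                : Rel Carrier 0ℓ
    isStrictTotalOrder : IsStrictTotalOrder _≈_ _<_
    0<1                : 0# < 1#
    +-monoˡ-<          : ∀ z {x y} → x < y → (x + z) < (y + z)
    *-pos              : ∀ {x y} → 0# < x → 0# < y → 0# < (x * y)
    inverse            : ∀ x → ¬ (x ≈ 0#) → ∃[ y ] ((x * y) ≈ 1#)

  open ToNonStrict _≈_ _<_ public using (_≤_)

  UpperBound : (Carrier → Set) → Carrier → Set
  UpperBound S u = ∀ x → S x → x ≤ u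

  field
    supremum : (S : Carrier → Set) → ∃ S → ∃ (UpperBound S) →
               ∃[ s ] (UpperBound S s × (∀ u → UpperBound S u → s ≤ u))

module OverReals (ℝ : CompleteOrderedField) where

  open CompleteOrderedField ℝ

  fromℕ : ℕ → Carrier
  fromℕ n = n · 1#
    where
    open RawMonoidDefs (CommutativeRing.+-rawMonoid commutativeRing)
      using () renaming (_×_ to _·_)

  -- Coefficient lists, constant term first.  Trailing zeros are allowed, so
  -- equality of polynomials is _≈ₚ_.
  Poly : Set
  Poly = List Carrier

  coeff : Poly → ℕ → Carrier
  coeff []      _       = 0#
  coeff (a ∷ p) zero    = a
  coeff (a ∷ p) (suc k) = coeff p k

  infix 4 _≈ₚ_
  _≈ₚ_ : Rel Poly 0ℓ
  p ≈ₚ q = ∀ k → coeff p k ≈ coeff q k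

  infixl 6 _+ₚ_
  infixl 7 _*ₚ_
  infixr 7 _∙ₚ_

  _+ₚ_ : Poly → Poly → Poly
  []      +ₚ q       = q
  (a ∷ p) +ₚ []      = a ∷ p
  (a ∷ p) +ₚ (b ∷ q) = (a + b) ∷ (p +ₚ q)

  _∙ₚ_ : Carrier → Poly → Poly
  c ∙ₚ p = map (c *_) p

  _*ₚ_ : Poly → Poly → Poly
  []      *ₚ q = []
  (a ∷ p) *ₚ q = (a ∙ₚ q) +ₚ (0# ∷ (p *ₚ q))

  𝟎 𝟏 X : Poly
  𝟎 = []
  𝟏 = 1# ∷ []
  X = 0# ∷ 1# ∷ []

  derivative : Poly → Poly
  derivative []      = []
  derivative (_ ∷ p) = weighted 1 p
    where
    weighted : ℕ → Poly → Poly
    weighted k []      = []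
    weighted k (a ∷ q) = (fromℕ k * a) ∷ weighted (suc k) q

  -- p(x²)
  substSquare : Poly → Poly
  substSquare []      = []
  substSquare (a ∷ p) = a ∷ 0# ∷ substSquare p

  HasDegree : Poly → ℕ → Set
  HasDegree p d = ¬ (coeff p d ≈ 0#) × (∀ k → d ℕ.< k → coeff p k ≈ 0#)

  DegreeAtMost : ℕ → Poly → Set
  DegreeAtMost n p = ∀ k → n ℕ.< k → coeff p k ≈ 0#

  -- The recurrences with n replaced by n + 1:  2(n+1) - 2 = 2n  and
  -- 2(n+1) - 1 = 2n + 1.
  M : ℕ → Poly
  M zero    = 𝟏
  M (suc n) = (fromℕ (2 ℕ.* n) ∙ₚ X +ₚ 𝟏) *ₚ M n
              +ₚ (fromℕ 2 ∙ₚ X) *ₚ (1# ∷ - 1# ∷ []) *ₚ derivative (M n)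

  M̃ : ℕ → Poly
  M̃ zero    = 𝟏
  M̃ (suc n) = (fromℕ (2 ℕ.* n ℕ.+ 1) ∙ₚ X) *ₚ M̃ n
              +ₚ (fromℕ 2 ∙ₚ X) *ₚ (1# ∷ - 1# ∷ []) *ₚ derivative (M̃ n)

  IsT : ℕ → Poly → Set
  IsT n T = (𝟏 +ₚ X) *ₚ T ≈ₚ X *ₚ substSquare (M n) +ₚ substSquare (M̃ n)

  record ℂ : Set where
    constructor _+i_
    field
      re : Carrier
      im : Carrier
  open ℂ public

  _+ᶜ_ _*ᶜ_ : ℂ → ℂ → ℂ
  (a +i b) +ᶜ (c +i d) = (a + c) +i (b + d)
  (a +i b) *ᶜ (c +i d) = (a * c - b * d) +i (a * d + b * c)

  evalᶜ : Poly → ℂ → ℂ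
  evalᶜ p z = foldr (λ a w → (a +i 0#) +ᶜ (z *ᶜ w)) (0# +i 0#) p

  IsZeroOf : Poly → ℂ → Set
  IsZeroOf p z = re (evalᶜ p z) ≈ 0# × im (evalᶜ p z) ≈ 0#

  HurwitzStable : Poly → Set
  HurwitzStable p = p ≈ₚ 𝟎 ⊎ (∀ z → 0# < re z → ¬ IsZeroOf p z)

  -- ℐ n p = xⁿ p(1/x), meaningful for p of degree at most n.
  ℐ : ℕ → Poly → Poly
  ℐ n p = applyUpTo (λ k → coeff p (n ∸ k)) (suc n)

  Symmetric : ℕ → Poly → Set
  Symmetric n p = DegreeAtMost n p × ℐ n p ≈ₚ p

  -- Symmetric with respect to n - 1; a polynomial of degree at most -1 is 0.
  SymmetricPred : ℕ → Poly → Set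
  SymmetricPred zero    p = p ≈ₚ 𝟎
  SymmetricPred (suc m) p = Symmetric m p

  IsDecomposition : ℕ → Poly → Poly → Poly → Set
  IsDecomposition n p a b =
    p ≈ₚ a +ₚ X *ₚ b × Symmetric n a × SymmetricPred n b

  ∏[X-_] : ∀ {d} → Vector Carrier d → Poly
  ∏[X- r ] = Vector.foldr (λ c p → (- c ∷ 1# ∷ []) *ₚ p) 𝟏 r

  -- p is nonzero of degree d with all zeros real, the zeros, repeated
  -- according to multiplicity, being r₁ ≥ r₂ ≥ ⋯ ≥ r_d.
  HasZeros : Poly → ∀ {d} → Vector Carrier d → Set
  HasZeros p {d} r =
    HasDegree p d × p ≈ₚ coeff p d ∙ₚ ∏[X- r ] ×
    (∀ i j → toℕ i ℕ.≤ toℕ j → r j ≤ r i)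

  RealRooted : Poly → Set
  RealRooted p = ∃[ d ] ∃[ r ] HasZeros p {d} r

  infix 4 _⪯_ _≪_

  -- Both chains say rᵢ₊₁ ≤ sᵢ ≤ rᵢ wherever the indices make sense.
  _⪯_ : Poly → Poly → Set
  g ⪯ f =
    (∃[ m ] ∃[ r ] ∃[ s ] (HasZeros f {suc m} r × HasZeros g {m} s ×
      (∀ i → r (suc i) ≤ s i × s i ≤ r (inject₁ i))))
    ⊎
    (∃[ d ] ∃[ r ] ∃[ s ] (HasZeros f {d} r × HasZeros g {d} s ×
      (∀ i → s i ≤ r i) ×
      (∀ i j → toℕ j ≡ suc (toℕ i) → r j ≤ s i)))

  IsLeadingCoeff : Poly → Carrier → Set
  IsLeadingCoeff p c = ∃[ d ] (HasDegree p d × c ≈ coeff p d)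

  SameSignLeading OppositeSignLeading : Poly → Poly → Set
  SameSignLeading f g =
    ∃[ c ] ∃[ e ] (IsLeadingCoeff f c × IsLeadingCoeff g e × 0# < (c * e))
  OppositeSignLeading f g =
    ∃[ c ] ∃[ e ] (IsLeadingCoeff f c × IsLeadingCoeff g e × (c * e) < 0#)

  _≪_ : Poly → Poly → Set
  g ≪ f =
    (g ⪯ f × SameSignLeading f g) ⊎
    (f ⪯ g × OppositeSignLeading f g) ⊎
    (g ≈ₚ 𝟎 × RealRooted f) ⊎
    (f ≈ₚ 𝟎 × RealRooted g)

  -- The chain 0 ≤ p₀ ≤ p_d ≤ p₁ ≤ p_{d-1} ≤ ⋯, where d = deg p, cut into the
  -- steps pᵢ ≤ p_{d-i} and p_{d-i} ≤ p_{i+1}; it ends at index ⌊(d+1)/2⌋.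
  AlternatinglyIncreasing : Poly → Set
  AlternatinglyIncreasing p =
    ∃[ d ] (HasDegree p d × 0# ≤ coeff p 0 ×
      (∀ i → 2 ℕ.* i ℕ.≤ d → coeff p i ≤ coeff p (d ∸ i)) ×
      (∀ i → 2 ℕ.* i ℕ.+ 1 ℕ.≤ d → coeff p (d ∸ i) ≤ coeff p (suc i)))

{-# OPTIONS --safe #-}
-- Write M̃ₙ = a + x b and Mₙ = a + b, so that T(x) = a(x²) + x b(x²).
--
-- Let ρ₁ = 0 > ρ₂ > ⋯ > ρₙ be the zeros of M̃ₙ, and assume that Mₙ has sign
-- (-1)ⁱ⁻¹ at ρᵢ.  Lagrange interpolation then gives
-- Mₙ / M̃ₙ = Σ cᵢ / (x - ρᵢ) with all cᵢ > 0.  The recurrence gives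
-- M̃ₙ₊₁ = x Q where Q has the sign of M̃ₙ′ at each ρᵢ, so the zeros of Q lie one
-- below each ρᵢ.  At such a zero τ the recurrences turn Mₙ₊₁ M̃ₙ into (1 - τ)
-- times the Wronskian, in the variable t with x = -t², of M̃ₙ and t Mₙ, which
-- is positive because the cᵢ are.  Hence Mₙ₊₁ alternates along the zeros of
-- M̃ₙ₊₁, and the induction continues.
--
-- Stability: for Re z > 0 each z / (z² - ρᵢ) has positive real part, so
-- z M(z²) / M̃(z²) cannot be -1.  Interlacing: b has a zero between consecutive
-- ρᵢ since M = (1 - ρ) b there, and a = M̃ at the zeros of b.  The alternating
-- increase is a separate induction on coefficients which uses only that M̃ₙ is
-- the reversal of Mₙ.
module Submission where

open import Defs
open import Algebra.Bundles using (CommutativeRing)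
import Algebra.Properties.Ring as RingProperties
import Algebra.Properties.Semiring.Mult as Multiples
import Algebra.Solver.Ring as RingSolver
open import Algebra.Solver.Ring.AlmostCommutativeRing
  using (_-Raw-AlmostCommutative⟶_; fromCommutativeRing)
open import Data.Fin.Base as Fin using (toℕ)
open import Data.Integer.Base as ℤ using (ℤ; +_; -[1+_]; _⊖_; _◃_)
import Data.Integer.Properties as ℤ
open import Data.List.Base using ([]; _∷_; applyUpTo; foldr; length)
open import Data.Maybe.Base using (Maybe; just; nothing)
open import Data.Nat.Base as ℕ using (ℕ; zero; suc; z≤n; s≤s; _∸_)
import Data.Nat.Properties as ℕ
open import Data.Product.Base using (_×_; _,_; proj₁; proj₂; ∃-syntax)
import Data.Sign.Base as Sign
open import Data.Sum.Base using (_⊎_; inj₁; inj₂)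
open import Data.Unit.Base using (⊤; tt)
open import Data.Vec.Base using (Vec; []; _∷_; lookup)
open import Data.Vec.Relation.Unary.All as All using (All; []; _∷_)
open import Data.Vec.Relation.Unary.All.Properties using (lookup⁺)
open import Data.Vec.Relation.Unary.AllPairs using (AllPairs; []; _∷_)
open import Level using (0ℓ)
open import Relation.Binary.Bundles using (StrictTotalOrder)
open import Relation.Binary.Definitions using (tri<; tri≈; tri>)
import Relation.Binary.Properties.StrictTotalOrder as StrictTotalOrderProperties
open import Relation.Binary.PropositionalEquality.Core as ≡ using (_≡_)
import Relation.Binary.Reasoning.Setoid as SetoidReasoning
open import Relation.Nullary.Decidable.Core using (yes; no)
open import Relation.Nullary.Negation.Core using (¬_; contradiction)

-- The variable `t` has a reason. With `x = -t²`, both `M̃ₙ(x)` and `t Mₙ(x)` obey one and the same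
-- recurrence `f ↦ (2n+1) x f + (1 - x) t f′`, the derivative being in `t`. Where the new `M̃`
-- vanishes, eliminating the common first term leaves only the Wronskian. Its sign is that of the
-- derivative of `t M / M̃ = Σ cᵢ t / (-t² - ρᵢ)`, and each summand has derivative
-- `cᵢ (t² - ρᵢ) / (t² + ρᵢ)²`, which is positive since `ρᵢ ≤ 0`. The induction starts at order 1,
-- because `M̃₀ = 1` lacks the zero 0. That `M̃ₙ` is the reversal of `Mₙ` comes from the
-- coefficients of `T`, whose recurrences are themselves invariant under reversal. It also gives
-- `Mₙ = a + b` for an arbitrary decomposition, and the coefficient inequalities make the leading
-- coefficient of `a` positive, as the interlacing requires. All analysis is reduced to polynomial
-- functions: continuity at `s` is `f x = f s + (x - s) g x` with `g` bounded near `s`, and zeros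
-- come from suprema.

-- Ring solver with integer constants.

module IntegerSolver {c ℓ} (R : CommutativeRing c ℓ) where

  open CommutativeRing R
  open RingProperties ring
    using (-0#≈0#; -‿involutive; -‿distribˡ-*; -‿distribʳ-*; -‿+-comm)
  open Multiples semiring using (×-homo-+; ×1-homo-*) renaming (_×_ to infixr 8 _·_)
  open SetoidReasoning setoid

  -- The literals 0 and 1 must denote 0# and 1# on the nose, and the literal
  -- n ≥ 2 the n-fold sum n · 1#, so that solver goals match source terms.
  ⟦_⟧⁺ : ℕ → Carrier
  ⟦ 0 ⟧⁺ = 0#
  ⟦ 1 ⟧⁺ = 1#
  ⟦ n ⟧⁺ = n · 1#

  ⟦_⟧ᶻ : ℤ → Carrier
  ⟦ + n ⟧ᶻ      = ⟦ n ⟧⁺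
  ⟦ -[1+ n ] ⟧ᶻ = - ⟦ suc n ⟧⁺

  ⟦⟧⁺≈× : ∀ n → ⟦ n ⟧⁺ ≈ n · 1#
  ⟦⟧⁺≈× 0             = refl
  ⟦⟧⁺≈× 1             = sym (+-identityʳ 1#)
  ⟦⟧⁺≈× (suc (suc n)) = refl

  ⟦⟧⁺-+ : ∀ m n → ⟦ m ℕ.+ n ⟧⁺ ≈ ⟦ m ⟧⁺ + ⟦ n ⟧⁺
  ⟦⟧⁺-+ m n = begin
    ⟦ m ℕ.+ n ⟧⁺      ≈⟨ ⟦⟧⁺≈× (m ℕ.+ n) ⟩
    (m ℕ.+ n) · 1#    ≈⟨ ×-homo-+ 1# m n ⟩
    m · 1# + n · 1#   ≈⟨ +-cong (⟦⟧⁺≈× m) (⟦⟧⁺≈× n) ⟨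
    ⟦ m ⟧⁺ + ⟦ n ⟧⁺   ∎

  ⟦⟧⁺-* : ∀ m n → ⟦ m ℕ.* n ⟧⁺ ≈ ⟦ m ⟧⁺ * ⟦ n ⟧⁺
  ⟦⟧⁺-* m n = begin
    ⟦ m ℕ.* n ⟧⁺          ≈⟨ ⟦⟧⁺≈× (m ℕ.* n) ⟩
    (m ℕ.* n) · 1#        ≈⟨ ×1-homo-* m n ⟩
    (m · 1#) * (n · 1#)   ≈⟨ *-cong (⟦⟧⁺≈× m) (⟦⟧⁺≈× n) ⟨
    ⟦ m ⟧⁺ * ⟦ n ⟧⁺       ∎

  ⟦⟧-neg : ∀ i → ⟦ ℤ.- i ⟧ᶻ ≈ - ⟦ i ⟧ᶻ
  ⟦⟧-neg (+ 0)       = sym -0#≈0#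
  ⟦⟧-neg (+ suc n)   = refl
  ⟦⟧-neg -[1+ n ]    = sym (-‿involutive _)

  ⟦⟧-⊖ : ∀ m n → ⟦ m ⊖ n ⟧ᶻ ≈ ⟦ m ⟧⁺ - ⟦ n ⟧⁺
  ⟦⟧-⊖ zero    zero    = sym (-‿inverseʳ 0#)
  ⟦⟧-⊖ zero    (suc n) = sym (+-identityˡ _)
  ⟦⟧-⊖ (suc m) zero    = sym (trans (+-congˡ -0#≈0#) (+-identityʳ _))
  ⟦⟧-⊖ (suc m) (suc n) = begin
    ⟦ suc m ⊖ suc n ⟧ᶻ                   ≡⟨ ≡.cong ⟦_⟧ᶻ (ℤ.[1+m]⊖[1+n]≡m⊖n m n) ⟩
    ⟦ m ⊖ n ⟧ᶻ                           ≈⟨ ⟦⟧-⊖ m n ⟩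
    ⟦ m ⟧⁺ - ⟦ n ⟧⁺                      ≈⟨ +-congʳ (+-identityʳ _) ⟨
    ⟦ m ⟧⁺ + 0# - ⟦ n ⟧⁺                 ≈⟨ +-congʳ (+-congˡ (-‿inverseʳ 1#)) ⟨
    ⟦ m ⟧⁺ + (1# - 1#) - ⟦ n ⟧⁺          ≈⟨ +-congʳ (+-assoc _ _ _) ⟨
    ⟦ m ⟧⁺ + 1# - 1# - ⟦ n ⟧⁺            ≈⟨ +-assoc _ _ _ ⟩
    ⟦ m ⟧⁺ + 1# + (- 1# - ⟦ n ⟧⁺)        ≈⟨ +-cong (⟦⟧⁺-+ m 1) (sym (-‿+-comm 1# _)) ⟨
    ⟦ m ℕ.+ 1 ⟧⁺ - (1# + ⟦ n ⟧⁺)         ≈⟨ +-cong (reflexive (≡.cong ⟦_⟧⁺ (ℕ.+-comm m 1))) (-‿cong (sym (⟦⟧⁺-+ 1 n))) ⟩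
    ⟦ suc m ⟧⁺ - ⟦ suc n ⟧⁺              ∎

  ⟦⟧-+ : ∀ i j → ⟦ i ℤ.+ j ⟧ᶻ ≈ ⟦ i ⟧ᶻ + ⟦ j ⟧ᶻ
  ⟦⟧-+ (+ m)    (+ n)    = ⟦⟧⁺-+ m n
  ⟦⟧-+ (+ m)    -[1+ n ] = ⟦⟧-⊖ m (suc n)
  ⟦⟧-+ -[1+ m ] (+ n)    = trans (⟦⟧-⊖ n (suc m)) (+-comm _ _)
  ⟦⟧-+ -[1+ m ] -[1+ n ] = begin
    - ⟦ suc (suc (m ℕ.+ n)) ⟧⁺           ≡⟨ ≡.cong (λ k → - ⟦ suc k ⟧⁺) (ℕ.+-suc m n) ⟨
    - ⟦ suc m ℕ.+ suc n ⟧⁺               ≈⟨ -‿cong (⟦⟧⁺-+ (suc m) (suc n)) ⟩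
    - (⟦ suc m ⟧⁺ + ⟦ suc n ⟧⁺)          ≈⟨ -‿+-comm _ _ ⟨
    - ⟦ suc m ⟧⁺ - ⟦ suc n ⟧⁺            ∎

  ⟦⟧-*-◃ : ∀ m n → ⟦ Sign.- ◃ (m ℕ.* n) ⟧ᶻ ≈ - (⟦ m ⟧⁺ * ⟦ n ⟧⁺)
  ⟦⟧-*-◃ m n = begin
    ⟦ Sign.- ◃ (m ℕ.* n) ⟧ᶻ   ≡⟨ ≡.cong ⟦_⟧ᶻ (ℤ.-◃n≡-n (m ℕ.* n)) ⟩
    ⟦ ℤ.- (+ (m ℕ.* n)) ⟧ᶻ    ≈⟨ ⟦⟧-neg (+ (m ℕ.* n)) ⟩
    - ⟦ m ℕ.* n ⟧⁺            ≈⟨ -‿cong (⟦⟧⁺-* m n) ⟩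
    - (⟦ m ⟧⁺ * ⟦ n ⟧⁺)       ∎

  ⟦⟧-* : ∀ i j → ⟦ i ℤ.* j ⟧ᶻ ≈ ⟦ i ⟧ᶻ * ⟦ j ⟧ᶻ
  ⟦⟧-* (+ m)    (+ n)    = trans (reflexive (≡.cong ⟦_⟧ᶻ (ℤ.+◃n≡+n (m ℕ.* n)))) (⟦⟧⁺-* m n)
  ⟦⟧-* (+ m)    -[1+ n ] = trans (⟦⟧-*-◃ m (suc n)) (-‿distribʳ-* _ _)
  ⟦⟧-* -[1+ m ] (+ n)    = trans (⟦⟧-*-◃ (suc m) n) (-‿distribˡ-* _ _)
  ⟦⟧-* -[1+ m ] -[1+ n ] = begin
    ⟦ suc m ℕ.* suc n ⟧⁺            ≈⟨ ⟦⟧⁺-* (suc m) (suc n) ⟩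
    ⟦ suc m ⟧⁺ * ⟦ suc n ⟧⁺         ≈⟨ -‿involutive _ ⟨
    - - (⟦ suc m ⟧⁺ * ⟦ suc n ⟧⁺)   ≈⟨ -‿cong (-‿distribˡ-* _ _) ⟩
    - (- ⟦ suc m ⟧⁺ * ⟦ suc n ⟧⁺)   ≈⟨ -‿distribʳ-* _ _ ⟩
    - ⟦ suc m ⟧⁺ * - ⟦ suc n ⟧⁺     ∎

  homomorphism : ℤ.+-*-rawRing -Raw-AlmostCommutative⟶ fromCommutativeRing R
  homomorphism = record
    { ⟦_⟧ = ⟦_⟧ᶻ ; +-homo = ⟦⟧-+ ; *-homo = ⟦⟧-* ; -‿homo = ⟦⟧-neg
    ; 0-homo = refl ; 1-homo = refl }

  decide : ∀ i j → Maybe (⟦ i ⟧ᶻ ≈ ⟦ j ⟧ᶻ)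
  decide i j with i ℤ.≟ j
  ... | yes i≡j = just (reflexive (≡.cong ⟦_⟧ᶻ i≡j))
  ... | no  _   = nothing

  open RingSolver ℤ.+-*-rawRing (fromCommutativeRing R) homomorphism decide public
    using (solve; _:=_; _:+_; _:*_; _:-_; :-_; con)

module _ (ℝ : CompleteOrderedField) where

  open CompleteOrderedField ℝ
  open OverReals ℝ
  open CommutativeRing commutativeRing
    using (refl; sym; trans; reflexive; +-cong; +-congˡ; +-congʳ; *-cong; *-congˡ; *-congʳ; -‿cong
          ; +-identityʳ; +-identityˡ; *-identityˡ; *-identityʳ; zeroˡ; zeroʳ; -‿inverseʳ)
  open IntegerSolver commutativeRing using (solve; _:=_; _:+_; _:*_; _:-_; :-_; con)

  -- Arithmetic of the ordered field.

  strictTotalOrder : StrictTotalOrder _ _ _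
  strictTotalOrder = record { isStrictTotalOrder = isStrictTotalOrder }

  open StrictTotalOrder strictTotalOrder
    using (compare; <-respʳ-≈; <-respˡ-≈; irrefl; asym) renaming (trans to <-trans)
  open StrictTotalOrderProperties strictTotalOrder
    using (≤-respʳ-≈; ≤-respˡ-≈)

  0<⇒≉0 : ∀ {x} → 0# < x → ¬ (x ≈ 0#)
  0<⇒≉0 0<x x≈0 = irrefl (sym x≈0) 0<x

  <⇒≱ : ∀ {x y} → x < y → ¬ (y ≤ x)
  <⇒≱ x<y (inj₁ y<x) = asym x<y y<x
  <⇒≱ x<y (inj₂ y≈x) = irrefl (sym y≈x) x<y

  <-≤-trans : ∀ {x y z} → x < y → y ≤ z → x < z
  <-≤-trans x<y (inj₁ y<z) = <-trans x<y y<z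
  <-≤-trans x<y (inj₂ y≈z) = <-respʳ-≈ y≈z x<y

  ≤-total : ∀ x y → x ≤ y ⊎ y < x
  ≤-total x y with compare x y
  ... | tri< x<y _ _ = inj₁ (inj₁ x<y)
  ... | tri≈ _ x≈y _ = inj₁ (inj₂ x≈y)
  ... | tri> _ _ y<x = inj₂ y<x

  <⇒0<- : ∀ {x y} → x < y → 0# < y - x
  <⇒0<- {x} x<y = <-respˡ-≈ (-‿inverseʳ x) (+-monoˡ-< (- x) x<y)

  0<-⇒< : ∀ {x y} → 0# < y - x → x < y
  0<-⇒< {x} {y} 0<y-x = <-respˡ-≈ (+-identityˡ x)
    (<-respʳ-≈ (solve 2 (λ x y → y :- x :+ x := y) refl x y) (+-monoˡ-< x 0<y-x))

  ≤⇒0≤- : ∀ {x y} → x ≤ y → 0# ≤ y - x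
  ≤⇒0≤- (inj₁ x<y)         = inj₁ (<⇒0<- x<y)
  ≤⇒0≤- {x} (inj₂ x≈y)     = inj₂ (trans (sym (-‿inverseʳ x)) (+-congʳ x≈y))

  0≤-⇒≤ : ∀ {x y} → 0# ≤ y - x → x ≤ y
  0≤-⇒≤ (inj₁ 0<y-x)         = inj₁ (0<-⇒< 0<y-x)
  0≤-⇒≤ {x} {y} (inj₂ 0≈y-x) = inj₂ (trans (sym (+-identityˡ x))
    (trans (+-congʳ 0≈y-x) (solve 2 (λ x y → y :- x :+ x := y) refl x y)))

  <0⇒0<- : ∀ {x} → x < 0# → 0# < - x
  <0⇒0<- x<0 = <-respʳ-≈ (+-identityˡ _) (<⇒0<- x<0)

  0<-⇒<0 : ∀ {x} → 0# < - x → x < 0#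
  0<-⇒<0 0<-x = 0<-⇒< (<-respʳ-≈ (sym (+-identityˡ _)) 0<-x)

  0<+0≤ : ∀ {x y} → 0# < x → 0# ≤ y → 0# < x + y
  0<+0≤ {x} {y} 0<x (inj₁ 0<y) =
    <-trans 0<y (<-respˡ-≈ (+-identityˡ y) (+-monoˡ-< y 0<x))
  0<+0≤ {x} {y} 0<x (inj₂ 0≈y) = <-respʳ-≈ (trans (sym (+-identityʳ x)) (+-congˡ 0≈y)) 0<x

  0<+0< : ∀ {x y} → 0# < x → 0# < y → 0# < x + y
  0<+0< 0<x 0<y = 0<+0≤ 0<x (inj₁ 0<y)

  0≤+0≤ : ∀ {x y} → 0# ≤ x → 0# ≤ y → 0# ≤ x + y
  0≤+0≤ (inj₁ 0<x) 0≤y = inj₁ (0<+0≤ 0<x 0≤y)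
  0≤+0≤ {x} {y} (inj₂ 0≈x) 0≤y = ≤-respʳ-≈ (trans (sym (+-identityˡ y)) (+-congʳ 0≈x)) 0≤y

  0≤*0≤ : ∀ {x y} → 0# ≤ x → 0# ≤ y → 0# ≤ x * y
  0≤*0≤ (inj₁ 0<x) (inj₁ 0<y) = inj₁ (*-pos 0<x 0<y)
  0≤*0≤ {x} _ (inj₂ 0≈y) = inj₂ (trans (sym (zeroʳ x)) (*-congˡ 0≈y))
  0≤*0≤ {x} {y} (inj₂ 0≈x) _ = inj₂ (trans (sym (zeroˡ y)) (*-congʳ 0≈x))

  x≉0⇒0<x² : ∀ {x} → ¬ (x ≈ 0#) → 0# < x * x
  x≉0⇒0<x² {x} x≉0 with compare 0# x
  ... | tri< 0<x _ _ = *-pos 0<x 0<x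
  ... | tri≈ _ 0≈x _ = contradiction (sym 0≈x) x≉0
  ... | tri> _ _ x<0 = <-respʳ-≈ (solve 1 (λ x → (:- x) :* (:- x) := x :* x) refl x)
                         (*-pos (<0⇒0<- x<0) (<0⇒0<- x<0))

  0≤x² : ∀ x → 0# ≤ x * x
  0≤x² x with compare 0# x
  ... | tri< 0<x _ _ = inj₁ (*-pos 0<x 0<x)
  ... | tri≈ _ 0≈x _ = inj₂ (trans (sym (zeroˡ x)) (*-congʳ 0≈x))
  ... | tri> _ _ x<0 = inj₁ (x≉0⇒0<x² (λ x≈0 → irrefl x≈0 x<0))

  *-cancel-0< : ∀ {x y} → 0# < x → 0# < x * y → 0# < y
  *-cancel-0< {x} {y} 0<x 0<xy with compare 0# y
  ... | tri< 0<y _ _ = 0<y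
  ... | tri≈ _ 0≈y _ = contradiction (trans (*-congˡ (sym 0≈y)) (zeroʳ x)) (0<⇒≉0 0<xy)
  ... | tri> _ _ y<0 = contradiction 0<xy (asym (0<-⇒<0
        (<-respʳ-≈ (solve 2 (λ x y → x :* (:- y) := :- (x :* y)) refl x y) (*-pos 0<x (<0⇒0<- y<0)))))

  *-cancel-≈0 : ∀ {x y} → ¬ (x ≈ 0#) → x * y ≈ 0# → y ≈ 0#
  *-cancel-≈0 {x} {y} x≉0 xy≈0 with inverse x x≉0
  ... | x⁻¹ , x*x⁻¹≈1 = trans (sym (*-identityˡ y)) (trans (*-congʳ (sym x*x⁻¹≈1))
        (trans (solve 3 (λ x y z → x :* z :* y := z :* (x :* y)) refl x y x⁻¹)
        (trans (*-congˡ xy≈0) (zeroʳ x⁻¹))))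

  abstract
    divide : ∀ {x} → 0# < x → ∀ y → ∃[ z ] z * x ≈ y × (0# < y → 0# < z)
    divide {x} 0<x y with inverse x (0<⇒≉0 0<x)
    ... | x⁻¹ , x*x⁻¹≈1 = x⁻¹ * y , z*x≈y
        , λ 0<y → *-cancel-0< 0<x (<-respʳ-≈ (trans (sym z*x≈y) (solve 2 (λ x z → z :* x := x :* z) refl x _)) 0<y)
      where
      z*x≈y : x⁻¹ * y * x ≈ y
      z*x≈y = trans (solve 3 (λ x y z → z :* y :* x := x :* z :* y) refl x y x⁻¹)
                (trans (*-congʳ x*x⁻¹≈1) (*-identityˡ y))

  fromℕ-+ : ∀ m n → fromℕ (m ℕ.+ n) ≈ fromℕ m + fromℕ n
  fromℕ-+ = Multiples.×-homo-+ (CommutativeRing.semiring commutativeRing) 1#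

  fromℕ-* : ∀ m n → fromℕ (m ℕ.* n) ≈ fromℕ m * fromℕ n
  fromℕ-* = Multiples.×1-homo-* (CommutativeRing.semiring commutativeRing)

  fromℕ-cong : ∀ {m n} → m ≡ n → fromℕ m ≈ fromℕ n
  fromℕ-cong ≡.refl = refl

  0≤fromℕ : ∀ n → 0# ≤ fromℕ n
  0≤fromℕ zero    = inj₂ refl
  0≤fromℕ (suc n) = inj₁ (0<+0≤ 0<1 (0≤fromℕ n))

  0<fromℕ-suc : ∀ n → 0# < fromℕ (suc n)
  0<fromℕ-suc n = 0<+0≤ 0<1 (0≤fromℕ n)

  fromℕ-mono-≤ : ∀ {m n} → m ℕ.≤ n → fromℕ m ≤ fromℕ n
  fromℕ-mono-≤ {m} {n} m≤n = 0≤-⇒≤ (≤-respʳ-≈ n-m (0≤fromℕ (n ℕ.∸ m)))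
    where
    n-m : fromℕ (n ℕ.∸ m) ≈ fromℕ n - fromℕ m
    n-m = trans (solve 2 (λ x y → y := x :+ y :- x) refl (fromℕ m) _)
      (+-congʳ (trans (sym (fromℕ-+ m (n ℕ.∸ m))) (fromℕ-cong (ℕ.m+[n∸m]≡n m≤n))))

  -- Polynomial functions.

  -- f agrees with a polynomial of degree at most m whose m-th coefficient is ℓ.
  data PolyFun : ℕ → Carrier → (Carrier → Carrier) → Set where
    constant : ∀ {ℓ f} → (∀ x → f x ≈ ℓ) → PolyFun 0 ℓ f
    horner   : ∀ {m ℓ f} c g → PolyFun m ℓ g → (∀ x → f x ≈ c + x * g x) → PolyFun (suc m) ℓ f

  PolyFun-cong : ∀ {m ℓ f g} → (∀ x → g x ≈ f x) → PolyFun m ℓ f → PolyFun m ℓ g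
  PolyFun-cong g≈f (constant f≈ℓ)     = constant λ x → trans (g≈f x) (f≈ℓ x)
  PolyFun-cong g≈f (horner c h p f≈) = horner c h p λ x → trans (g≈f x) (f≈ x)

  PolyFun-congˡ : ∀ {m k ℓ f} → k ≈ ℓ → PolyFun m k f → PolyFun m ℓ f
  PolyFun-congˡ k≈ℓ (constant f≈k)    = constant λ x → trans (f≈k x) k≈ℓ
  PolyFun-congˡ k≈ℓ (horner c g p f≈) = horner c g (PolyFun-congˡ k≈ℓ p) f≈

  PolyFun-resp : ∀ {m ℓ f} → PolyFun m ℓ f → ∀ {x y} → x ≈ y → f x ≈ f y
  PolyFun-resp (constant f≈ℓ)    x≈y = trans (f≈ℓ _) (sym (f≈ℓ _))
  PolyFun-resp (horner c g p f≈) x≈y =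
    trans (f≈ _) (trans (+-congˡ (*-cong x≈y (PolyFun-resp p x≈y))) (sym (f≈ _)))

  PolyFun-+ : ∀ {m k ℓ f g} → PolyFun m k f → PolyFun m ℓ g → PolyFun m (k + ℓ) (λ x → f x + g x)
  PolyFun-+ (constant f≈k)    (constant g≈ℓ)    = constant λ x → +-cong (f≈k x) (g≈ℓ x)
  PolyFun-+ (horner c f p f≈) (horner d g q g≈) = horner (c + d) (λ x → f x + g x) (PolyFun-+ p q)
    λ x → trans (+-cong (f≈ x) (g≈ x))
      (solve 5 (λ c d x f g → c :+ x :* f :+ (d :+ x :* g) := c :+ d :+ x :* (f :+ g)) refl c d x (f x) (g x))

  PolyFun-scale : ∀ a {m ℓ f} → PolyFun m ℓ f → PolyFun m (a * ℓ) (λ x → a * f x)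
  PolyFun-scale a (constant f≈ℓ)    = constant λ x → *-congˡ (f≈ℓ x)
  PolyFun-scale a (horner c f p f≈) = horner (a * c) (λ x → a * f x) (PolyFun-scale a p)
    λ x → trans (*-congˡ (f≈ x))
      (solve 4 (λ a c x f → a :* (c :+ x :* f) := a :* c :+ x :* (a :* f)) refl a c x (f x))

  PolyFun-neg : ∀ {m ℓ f} → PolyFun m ℓ f → PolyFun m (- 1# * ℓ) (λ x → - f x)
  PolyFun-neg {f = f} p = PolyFun-cong
    (λ x → solve 1 (λ y → :- y := (:- con (+ 1)) :* y) refl (f x)) (PolyFun-scale (- 1#) p)

  abstract
    -- Horner division: if `g x = g r + (x - r) h x`, then
    -- `c + x g x = f r + (x - r) (g r + x h x)`. The leading coefficient passes to the quotient
    -- unchanged.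
    factor : ∀ r {m ℓ f} → PolyFun (suc m) ℓ f →
             ∃[ g ] PolyFun m ℓ g × (∀ x → f x ≈ f r + (x - r) * g x)
    factor r {f = f} (horner c g (constant g≈ℓ) f≈) = g , constant g≈ℓ , λ x →
      trans (f≈ x) (trans (solve 4 (λ c x r g → c :+ x :* g := c :+ r :* g :+ (x :- r) :* g) refl c x r (g x))
        (+-congʳ (sym (trans (f≈ r) (+-congˡ (*-congˡ (trans (g≈ℓ r) (sym (g≈ℓ x)))))))))
    factor r {f = f} (horner c g p@(horner _ _ _ _) f≈) with factor r p
    ... | h , q , g≈ = (λ x → g r + x * h x) , horner (g r) h q (λ _ → refl) , λ x →
      trans (f≈ x) (trans (+-congˡ (*-congˡ (g≈ x)))
        (trans (solve 5 (λ c x r g h → c :+ x :* (g :+ (x :- r) :* h)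
                  := c :+ r :* g :+ (x :- r) :* (g :+ x :* h)) refl c x r (g r) (h x))
          (+-congʳ (sym (f≈ r)))))

  -- Bounds, continuity and the intermediate value theorem.

  infix 4 ∣_∣≤_
  -- Two inequalities in place of an absolute value: bounds then add and multiply by ring
  -- identities, without cases on the sign of `x`.
  ∣_∣≤_ : Carrier → Carrier → Set
  ∣ x ∣≤ b = 0# ≤ b - x × 0# ≤ b + x

  ∣∣≤-cong : ∀ {x y b} → x ≈ y → ∣ x ∣≤ b → ∣ y ∣≤ b
  ∣∣≤-cong x≈y (l , u) = ≤-respʳ-≈ (+-congˡ (-‿cong x≈y)) l , ≤-respʳ-≈ (+-congˡ x≈y) u

  ∣∣≤-mono : ∀ {x b c} → b ≤ c → ∣ x ∣≤ b → ∣ x ∣≤ c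
  ∣∣≤-mono {x} {b} {c} b≤c (l , u) =
      ≤-respʳ-≈ (solve 3 (λ x b c → c :- b :+ (b :- x) := c :- x) refl x b c) (0≤+0≤ (≤⇒0≤- b≤c) l)
    , ≤-respʳ-≈ (solve 3 (λ x b c → c :- b :+ (b :+ x) := c :+ x) refl x b c) (0≤+0≤ (≤⇒0≤- b≤c) u)

  ∣∣≤-+ : ∀ {x y b c} → ∣ x ∣≤ b → ∣ y ∣≤ c → ∣ x + y ∣≤ b + c
  ∣∣≤-+ {x} {y} {b} {c} (l , u) (l′ , u′) =
      ≤-respʳ-≈ (solve 4 (λ x y b c → b :- x :+ (c :- y) := b :+ c :- (x :+ y)) refl x y b c) (0≤+0≤ l l′)
    , ≤-respʳ-≈ (solve 4 (λ x y b c → b :+ x :+ (c :+ y) := b :+ c :+ (x :+ y)) refl x y b c) (0≤+0≤ u u′)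

  0≤x+x⇒0≤x : ∀ {x} → 0# ≤ x + x → 0# ≤ x
  0≤x+x⇒0≤x {x} 0≤2x with ≤-total 0# x
  ... | inj₁ 0≤x = 0≤x
  ... | inj₂ x<0 = contradiction 0≤2x (<⇒≱ (0<-⇒<0
        (<-respʳ-≈ (solve 1 (λ x → :- x :- x := :- (x :+ x)) refl x) (0<+0< (<0⇒0<- x<0) (<0⇒0<- x<0)))))

  -- `(b - x)(c + y) + (b + x)(c - y)` is twice `b c - x y`, and flipping the sign of `y` gives
  -- twice `b c + x y`. All factors are nonnegative.
  ∣∣≤-* : ∀ {x y b c} → ∣ x ∣≤ b → ∣ y ∣≤ c → ∣ x * y ∣≤ b * c
  ∣∣≤-* {x} {y} {b} {c} (l , u) (l′ , u′) =
      0≤x+x⇒0≤x (≤-respʳ-≈ (solve 4 (λ x y b c →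
        (b :- x) :* (c :+ y) :+ (b :+ x) :* (c :- y) := (b :* c :- x :* y) :+ (b :* c :- x :* y))
        refl x y b c) (0≤+0≤ (0≤*0≤ l u′) (0≤*0≤ u l′)))
    , 0≤x+x⇒0≤x (≤-respʳ-≈ (solve 4 (λ x y b c →
        (b :- x) :* (c :- y) :+ (b :+ x) :* (c :+ y) := (b :* c :+ x :* y) :+ (b :* c :+ x :* y))
        refl x y b c) (0≤+0≤ (0≤*0≤ l l′) (0≤*0≤ u u′)))

  bounded : ∀ x → ∃[ b ] ∣ x ∣≤ b × 0# ≤ b
  bounded x with ≤-total 0# x
  ... | inj₁ 0≤x = x , (inj₂ (sym (-‿inverseʳ x)) , 0≤+0≤ 0≤x 0≤x) , 0≤x
  ... | inj₂ x<0 = - x , (0≤+0≤ 0≤-x 0≤-x , inj₂ (solve 1 (λ x → con (+ 0) := :- x :+ x) refl x)) , 0≤-x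
    where
    0≤-x : 0# ≤ - x
    0≤-x = inj₁ (<0⇒0<- x<0)

  PolyFun-bounded : ∀ {k} → 0# ≤ k → ∀ {m ℓ f} → PolyFun m ℓ f →
                    ∃[ b ] (∀ x → ∣ x ∣≤ k → ∣ f x ∣≤ b) × 0# ≤ b
  PolyFun-bounded 0≤k {ℓ = ℓ} (constant f≈ℓ) with bounded ℓ
  ... | b , ∣ℓ∣≤b , 0≤b = b , (λ x _ → ∣∣≤-cong (sym (f≈ℓ x)) ∣ℓ∣≤b) , 0≤b
  PolyFun-bounded {k} 0≤k (horner c g p f≈) with bounded c | PolyFun-bounded 0≤k p
  ... | a , ∣c∣≤a , 0≤a | b , ∣g∣≤b , 0≤b = a + k * b
      , (λ x ∣x∣≤k → ∣∣≤-cong (sym (f≈ x)) (∣∣≤-+ ∣c∣≤a (∣∣≤-* ∣x∣≤k (∣g∣≤b x ∣x∣≤k))))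
      , 0≤+0≤ 0≤a (0≤*0≤ 0≤k 0≤b)

  abstract
    locally-positive : ∀ {m ℓ f} → PolyFun m ℓ f → ∀ s → 0# < f s →
                       ∃[ δ ] 0# < δ × (∀ x → ∣ x - s ∣≤ δ → 0# < f x)
    locally-positive (constant f≈ℓ) s 0<fs = 1# , 0<1 , λ x _ → <-respʳ-≈ (trans (f≈ℓ s) (sym (f≈ℓ x))) 0<fs
    locally-positive {f = f} p@(horner _ _ _ _) s 0<fs with factor s p | bounded s
    ... | g , q , f≈ | a , ∣s∣≤a , 0≤a with PolyFun-bounded (0≤+0≤ 0≤a (inj₁ 0<1)) q
    -- The radius is `δ = f s / (f s + 1 + b)`. It is at most 1, which keeps `x` in the region where
    -- `b` bounds `g`, and `f s - δ b = δ (f s + 1)` is positive.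
    ... | b , ∣g∣≤b , 0≤b with divide (0<+0≤ (0<+0< 0<fs 0<1) 0≤b) (f s)
    ... | δ , δ*≈ , 0<δ′ = δ , 0<δ , positive
      where
      0<δ : 0# < δ
      0<δ = 0<δ′ 0<fs

      δ≤1 : δ ≤ 1#
      δ≤1 = inj₁ (0<-⇒< (*-cancel-0< (0<+0≤ (0<+0< 0<fs 0<1) 0≤b) (<-respʳ-≈
        (trans (solve 2 (λ y b → con (+ 1) :+ b := y :+ con (+ 1) :+ b :- y) refl (f s) b)
          (trans (+-congˡ (-‿cong (sym δ*≈)))
            (solve 2 (λ z d → z :- d :* z := z :* (con (+ 1) :- d)) refl (f s + 1# + b) δ)))
        (0<+0≤ 0<1 0≤b))))

      positive : ∀ x → ∣ x - s ∣≤ δ → 0# < f x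
      positive x ∣x-s∣≤δ = <-respʳ-≈ (sym (f≈ x)) (<-respʳ-≈
        (trans (+-congʳ (trans (solve 3 (λ d y b → d :* (y :+ con (+ 1)) := d :* (y :+ con (+ 1) :+ b) :- d :* b)
                  refl δ (f s) b) (+-congʳ δ*≈)))
          (solve 3 (λ y db w → y :- db :+ (db :+ w) := y :+ w) refl (f s) (δ * b) ((x - s) * g x)))
        (0<+0≤ (*-pos 0<δ (0<+0< 0<fs 0<1)) (proj₂ (∣∣≤-* ∣x-s∣≤δ (∣g∣≤b x ∣x∣≤a+1)))))
        where
        ∣x∣≤a+1 : ∣ x ∣≤ a + 1#
        ∣x∣≤a+1 = ∣∣≤-cong (solve 2 (λ x s → s :+ (x :- s) := x) refl x s)
          (∣∣≤-+ ∣s∣≤a (∣∣≤-mono δ≤1 ∣x-s∣≤δ))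

  abstract
    locally-negative : ∀ {m ℓ f} → PolyFun m ℓ f → ∀ s → f s < 0# →
                       ∃[ δ ] 0# < δ × (∀ x → ∣ x - s ∣≤ δ → f x < 0#)
    locally-negative p s fs<0 with locally-positive (PolyFun-neg p) s (<0⇒0<- fs<0)
    ... | δ , 0<δ , -f>0 = δ , 0<δ , λ x ∣x-s∣≤δ → 0<-⇒<0 (-f>0 x ∣x-s∣≤δ)

  abstract
    -- The zero is the supremum `s` of the points up to `r` where `f` is negative. If `f s < 0`,
    -- then `f` is still negative at `s + δ`, or at `r` when `s + δ` passes `r`; if `f s > 0`, then
    -- `s - δ` is a smaller upper bound.
    intermediate-value : ∀ {m ℓ f} → PolyFun m ℓ f → ∀ {l r} → l < r → f l < 0# → 0# < f r →
                         ∃[ s ] l < s × s < r × f s ≈ 0#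
    intermediate-value {f = f} p {l} {r} l<r fl<0 0<fr
      with supremum (λ x → x ≤ r × f x < 0#) (l , inj₁ l<r , fl<0) (r , λ _ → proj₁)
    ... | s , ub , least = result
      where
      l≤s : l ≤ s
      l≤s = ub l (inj₁ l<r , fl<0)

      s≤r : s ≤ r
      s≤r = least r (λ _ → proj₁)

      strict : ∀ {x y} → x ≤ y → ¬ (x ≈ y) → x < y
      strict (inj₁ x<y) _   = x<y
      strict (inj₂ x≈y) x≉y = contradiction x≈y x≉y

      ¬fs<0 : ¬ (f s < 0#)
      ¬fs<0 fs<0 with locally-negative p s fs<0
      ... | δ , 0<δ , f<0 with ≤-total (s + δ) r
      ... | inj₁ s+δ≤r = <⇒≱ s<s+δ (ub (s + δ) (s+δ≤r , f<0 (s + δ)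
            ( inj₂ (solve 2 (λ s d → con (+ 0) := d :- (s :+ d :- s)) refl s δ)
            , ≤-respʳ-≈ (solve 2 (λ s d → d :+ d := d :+ (s :+ d :- s)) refl s δ) (0≤+0≤ (inj₁ 0<δ) (inj₁ 0<δ)))))
        where
        s<s+δ : s < s + δ
        s<s+δ = 0<-⇒< (<-respʳ-≈ (solve 2 (λ s d → d := s :+ d :- s) refl s δ) 0<δ)
      ... | inj₂ r<s+δ = asym 0<fr (f<0 r
            ( inj₁ (<-respʳ-≈ (solve 3 (λ r s d → s :+ d :- r := d :- (r :- s)) refl r s δ) (<⇒0<- r<s+δ))
            , 0≤+0≤ (inj₁ 0<δ) (≤⇒0≤- s≤r)))

      ¬0<fs : ¬ (0# < f s)
      ¬0<fs 0<fs with locally-positive p s 0<fs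
      ... | δ , 0<δ , f>0 = <⇒≱ s-δ<s (least (s - δ) s-δ-ub)
        where
        s-δ<s : s - δ < s
        s-δ<s = 0<-⇒< (<-respʳ-≈ (solve 2 (λ s d → d := s :- (s :- d)) refl s δ) 0<δ)

        s-δ-ub : ∀ x → x ≤ r × f x < 0# → x ≤ s - δ
        s-δ-ub x (x≤r , fx<0) with ≤-total x (s - δ)
        ... | inj₁ x≤s-δ = x≤s-δ
        ... | inj₂ s-δ<x = contradiction fx<0 (asym (f>0 x
              ( ≤-respʳ-≈ (solve 3 (λ x s d → d :+ (s :- x) := d :- (x :- s)) refl x s δ)
                  (0≤+0≤ (inj₁ 0<δ) (≤⇒0≤- (ub x (x≤r , fx<0))))
              , inj₁ (<-respʳ-≈ (solve 3 (λ x s d → x :- (s :- d) := d :+ (x :- s)) refl x s δ) (<⇒0<- s-δ<x)))))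

      result : ∃[ s ] l < s × s < r × f s ≈ 0#
      result with compare (f s) 0#
      ... | tri< fs<0 _ _ = contradiction fs<0 ¬fs<0
      ... | tri> _ _ 0<fs = contradiction 0<fs ¬0<fs
      ... | tri≈ _ fs≈0 _ = s
          , strict l≤s (λ l≈s → irrefl (trans (PolyFun-resp p l≈s) fs≈0) fl<0)
          , strict s≤r (λ s≈r → irrefl (trans (sym fs≈0) (PolyFun-resp p s≈r)) 0<fr)
          , fs≈0

  -- Products over zeros, Lagrange sums and alternating signs.

  ∏ ∏′ : ∀ {n} → Vec Carrier n → Carrier → Carrier
  ∏ []      x = 1#
  ∏ (ρ ∷ v) x = (x - ρ) * ∏ v x
  ∏′ []      x = 0#
  ∏′ (ρ ∷ v) x = ∏ v x + (x - ρ) * ∏′ v x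

  -- lagrange v c x = Σᵢ cᵢ Π_{j≠i} (x - vⱼ).
  lagrange lagrange′ : ∀ {n} → Vec Carrier n → Vec Carrier n → Carrier → Carrier
  lagrange []      []      x = 0#
  lagrange (ρ ∷ v) (c ∷ w) x = c * ∏ v x + (x - ρ) * lagrange v w x
  lagrange′ []      []      x = 0#
  lagrange′ (ρ ∷ v) (c ∷ w) x = c * ∏′ v x + (lagrange v w x + (x - ρ) * lagrange′ v w x)

  Descending : ∀ {n} → Vec Carrier n → Set
  Descending = AllPairs (λ x y → y < x)

  Alternating : (Carrier → Carrier) → ∀ {n} → Vec Carrier n → Set
  Alternating f []      = ⊤
  Alternating f (ρ ∷ v) = 0# < f ρ × Alternating (λ x → - f x) v

  -- v ⋗ w says v₁ > w₁ > v₂ > w₂ > ⋯, the lengths being equal or v having one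
  -- more entry.
  infix 4 _⋗_
  data _⋗_ : ∀ {m n} → Vec Carrier m → Vec Carrier n → Set where
    []  : [] ⋗ []
    _∷_ : ∀ {m n ρ} {v : Vec Carrier m} {w : Vec Carrier n} →
          All (_< ρ) w → w ⋗ v → (ρ ∷ v) ⋗ w

  infix 4 _⇛_
  -- Transfer of sign. Both signs are recorded because `Alternating` negates its function from each
  -- entry to the next, so the relation has to survive negation of both sides.
  record _⇛_ (x y : Carrier) : Set where
    constructor _,_
    field
      positive : 0# < x → 0# < y
      negative : 0# < - x → 0# < - y

  ⇛-neg : ∀ {x y} → x ⇛ y → - x ⇛ - y
  ⇛-neg {x} {y} (pos , neg) = neg , λ 0<--x → <-respʳ-≈ (involutive y) (pos (<-respʳ-≈ (sym (involutive x)) 0<--x))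
    where
    involutive : ∀ x → x ≈ - - x
    involutive = solve 1 (λ x → x := :- :- x) refl

  -*ʳ : ∀ x y → - (x * y) ≈ x * - y
  -*ʳ = solve 2 (λ x y → :- (x :* y) := x :* (:- y)) refl

  positive-multiple-⇛ : ∀ {c x y} → 0# < c → y ≈ c * x → x ⇛ y
  positive-multiple-⇛ {c} {x} 0<c y≈cx =
      (λ 0<x → <-respʳ-≈ (sym y≈cx) (*-pos 0<c 0<x))
    , (λ 0<-x → <-respʳ-≈ (sym (trans (-‿cong y≈cx) (-*ʳ c x))) (*-pos 0<c 0<-x))

  positive-quotient-⇛ : ∀ {c x y} → 0# < c → x ≈ c * y → x ⇛ y
  positive-quotient-⇛ {c} {x} {y} 0<c x≈cy =
      (λ 0<x → *-cancel-0< 0<c (<-respʳ-≈ x≈cy 0<x))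
    , (λ 0<-x → *-cancel-0< 0<c (<-respʳ-≈ (trans (-‿cong x≈cy) (-*ʳ c y)) 0<-x))

  positive-product-⇛ : ∀ {x y} → 0# < x * y → x ⇛ y
  positive-product-⇛ {x} {y} 0<xy =
      (λ 0<x → *-cancel-0< 0<x 0<xy)
    , (λ 0<-x → *-cancel-0< 0<-x (<-respʳ-≈ (solve 2 (λ x y → x :* y := (:- x) :* (:- y)) refl x y) 0<xy))

  Alternating-⇛ : ∀ {n} {v : Vec Carrier n} {f g} → All (λ x → f x ⇛ g x) v → Alternating f v → Alternating g v
  Alternating-⇛ []       tt        = tt
  Alternating-⇛ (p ∷ ps) (0<f , a) = _⇛_.positive p 0<f , Alternating-⇛ (All.map ⇛-neg ps) a

  ∏-positive : ∀ {n} {v : Vec Carrier n} {x} → All (_< x) v → 0# < ∏ v x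
  ∏-positive []           = 0<1
  ∏-positive (ρ<x ∷ v<x)  = *-pos (<⇒0<- ρ<x) (∏-positive v<x)

  ∏-zeros : ∀ {n} (v : Vec Carrier n) → All (λ x → ∏ v x ≈ 0#) v
  ∏-zeros []      = []
  ∏-zeros (ρ ∷ v) = trans (*-congʳ (-‿inverseʳ ρ)) (zeroˡ _)
                  ∷ All.map (λ ∏≈0 → trans (*-congˡ ∏≈0) (zeroʳ _)) (∏-zeros v)

  ∏-PolyFun : ∀ {n} (v : Vec Carrier n) → PolyFun n 1# (∏ v)
  ∏-PolyFun []      = constant λ _ → refl
  ∏-PolyFun (ρ ∷ v) = times (∏-PolyFun v)
    where
    times : ∀ {m ℓ f} → PolyFun m ℓ f → PolyFun (suc m) ℓ (λ x → (x - ρ) * f x)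
    times {ℓ = ℓ} {f} (constant f≈ℓ) = horner (- ρ * ℓ) f (constant f≈ℓ) λ x →
      trans (solve 3 (λ x r y → (x :- r) :* y := (:- r) :* y :+ x :* y) refl x ρ (f x))
        (+-congʳ (*-congˡ (f≈ℓ x)))
    times {ℓ = ℓ} {f} (horner c g p f≈) = horner (- ρ * c) (λ x → c + (x - ρ) * g x)
      (PolyFun-congˡ (+-identityˡ _) (PolyFun-+ (constant-suc c) (times p)))
      λ x → trans (*-congˡ (f≈ x)) (solve 4 (λ x r c g →
        (x :- r) :* (c :+ x :* g) := (:- r) :* c :+ x :* (c :+ (x :- r) :* g)) refl x ρ c (g x))
      where
      -- The constant is padded with zero coefficients up to formal degree `suc m`, so that adding
      -- it leaves the leading coefficient `ℓ` alone.
      constant-suc : ∀ c {m} → PolyFun (suc m) 0# (λ _ → c)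
      constant-suc c = horner c (λ _ → 0#) (zero-PolyFun _) λ x → sym (trans (+-congˡ (zeroʳ x)) (+-identityʳ c))
        where
        zero-PolyFun : ∀ m → PolyFun m 0# (λ _ → 0#)
        zero-PolyFun zero    = constant λ _ → refl
        zero-PolyFun (suc m) = horner 0# (λ _ → 0#) (zero-PolyFun m) λ x → sym (trans (+-identityˡ _) (zeroʳ x))

  -- To the left of `τ` the factor `x - τ` is negative, so dividing it out flips every sign. This is
  -- what lets an alternating pattern start afresh at the next point.
  negative-factor-⇛ : ∀ {n} {v : Vec Carrier n} {τ} {f g : Carrier → Carrier} →
                      All (_< τ) v → All (λ x → f x ≈ (x - τ) * g x) v →
                      All (λ x → - f x ⇛ g x) v
  negative-factor-⇛ []           []         = []
  negative-factor-⇛ {τ = τ} {g = g} (x<τ ∷ v<τ) (f≈ ∷ fs≈) = positive-quotient-⇛ (<⇒0<- x<τ) (trans (-‿cong f≈)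
        (solve 3 (λ x t g → :- ((x :- t) :* g) := (t :- x) :* g) refl _ τ (g _)))
    ∷ negative-factor-⇛ v<τ fs≈

  -- At the largest zero the derivative is the product over the others, which is positive. At any
  -- other zero `x` it is `(x - ρ) ∏′ v x`, with a negative first factor, so the recursion applies
  -- with flipped sign.
  ∏′-alternating : ∀ {n} {v : Vec Carrier n} → Descending v → Alternating (∏′ v) v
  ∏′-alternating []                  = tt
  ∏′-alternating {v = ρ ∷ v} (v<ρ ∷ desc) =
      <-respʳ-≈ (sym (trans (+-congˡ (trans (*-congʳ (-‿inverseʳ ρ)) (zeroˡ _))) (+-identityʳ _))) (∏-positive v<ρ)
    , Alternating-⇛ (All.map (λ { {x} (x<ρ , ∏≈0) → positive-multiple-⇛ (<⇒0<- x<ρ)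
        (trans (-‿cong (+-congʳ ∏≈0))
          (solve 3 (λ x r y → :- (con (+ 0) :+ (x :- r) :* y) := (r :- x) :* y) refl x ρ (∏′ v x))) })
        (All.zip (v<ρ , ∏-zeros v))) (∏′-alternating desc)

  ⋗-all< : ∀ {m n ρ} {v : Vec Carrier m} {w : Vec Carrier n} → (ρ ∷ v) ⋗ w → All (_< ρ) v
  ⋗-all< (_ ∷ [])                       = []
  ⋗-all< ((τ<ρ ∷ _) ∷ (v<τ ∷ _))        = All.map (λ x<τ → <-trans x<τ τ<ρ) v<τ

  ⋗-descending : ∀ {m n} {v : Vec Carrier m} {w : Vec Carrier n} → v ⋗ w → Descending v × Descending w
  ⋗-descending []            = [] , []
  ⋗-descending i@(_ ∷ w⋗v) = ⋗-all< i ∷ proj₂ (⋗-descending w⋗v) , proj₁ (⋗-descending w⋗v)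

  -- Both halves are proved together because the tail of an interleaving exchanges the roles of the
  -- two vectors.
  ⋗-alternating : ∀ {m n} {v : Vec Carrier m} {w : Vec Carrier n} → v ⋗ w →
                  Alternating (∏ w) v × Alternating (λ x → - ∏ v x) w
  ⋗-alternating []           = tt , tt
  ⋗-alternating {v = ρ ∷ v} (w<ρ ∷ w⋗v) =
      (∏-positive w<ρ , proj₂ (⋗-alternating w⋗v))
    , Alternating-⇛ (All.map (λ {x} x<ρ → positive-multiple-⇛ (<⇒0<- x<ρ)
        (solve 3 (λ x r y → :- ((x :- r) :* y) := (r :- x) :* y) refl x ρ (∏ v x))) w<ρ)
        (proj₁ (⋗-alternating w⋗v))

  -- Zeros located by sign changes, and interpolation.

  abstract
    root-between : ∀ {m ℓ f ρ ρ′} → PolyFun (suc m) ℓ f → ρ′ < ρ → 0# < f ρ → 0# < - f ρ′ →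
                   ∃[ τ ] ∃[ g ] ρ′ < τ × τ < ρ × PolyFun m ℓ g × (∀ x → f x ≈ (x - τ) * g x)
    root-between p ρ′<ρ 0<fρ 0<-fρ′ with intermediate-value p ρ′<ρ (0<-⇒<0 0<-fρ′) 0<fρ
    ... | τ , ρ′<τ , τ<ρ , fτ≈0 with factor τ p
    ... | g , q , f≈ = τ , g , ρ′<τ , τ<ρ , q , λ x → trans (f≈ x) (trans (+-congʳ fτ≈0) (+-identityˡ _))

  FactorsOver : ∀ {n} → Carrier → (Carrier → Carrier) → Vec Carrier n → Set
  FactorsOver ℓ f w = ∀ x → f x ≈ ℓ * ∏ w x

  FactorsOver-∷ : ∀ {n ℓ f g τ} {w : Vec Carrier n} → (∀ x → f x ≈ (x - τ) * g x) →
                  FactorsOver ℓ g w → FactorsOver ℓ f (τ ∷ w)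
  FactorsOver-∷ {ℓ = ℓ} {τ = τ} {w} f≈ g≈ x = trans (f≈ x) (trans (*-congˡ (g≈ x))
    (solve 3 (λ d l y → d :* (l :* y) := l :* (d :* y)) refl (x - τ) ℓ (∏ w x)))

  -- The common step of `roots-between` and `roots-below`: a zero `τ` between the first two points
  -- is divided out, and the quotient alternates from the second point on. The last component puts
  -- `τ` back in front of the zeros found for the quotient.
  split-root : ∀ {m n ℓ f ρ ρ′} {v : Vec Carrier n} → PolyFun (suc m) ℓ f →
               Descending (ρ ∷ ρ′ ∷ v) → Alternating f (ρ ∷ ρ′ ∷ v) →
               ∃[ g ] PolyFun m ℓ g × Alternating g (ρ′ ∷ v) ×
                 (∀ {k} (w : Vec Carrier k) → (ρ′ ∷ v) ⋗ w → FactorsOver ℓ g w →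
                    ∃[ w′ ] (ρ ∷ ρ′ ∷ v) ⋗ w′ × FactorsOver {suc k} ℓ f w′)
  split-root {ρ = ρ} {v = v} p ((ρ′<ρ ∷ _) ∷ (v<ρ′ ∷ _)) (0<fρ , alt@(0<-fρ′ , _))
    with root-between p ρ′<ρ 0<fρ 0<-fρ′
  ... | τ , g , ρ′<τ , τ<ρ , q , f≈ = g , q
      , Alternating-⇛ (negative-factor-⇛ v<τ (All.universal f≈ _)) alt
      , λ { w v⋗w@(w<ρ′ ∷ _) g≈ → τ ∷ w
          , (τ<ρ ∷ All.map (λ x<ρ′ → <-trans x<ρ′ ρ′<ρ) w<ρ′) ∷ (v<τ ∷ v⋗w)
          , FactorsOver-∷ {w = w} f≈ g≈ }
    where
    v<τ : All (_< τ) (_ ∷ v)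
    v<τ = ρ′<τ ∷ All.map (λ x<ρ′ → <-trans x<ρ′ ρ′<τ) v<ρ′

  -- The `suc m` alternating signs force `m` zeros, which exhaust the degree; hence the complete
  -- factorisation.
  roots-between : ∀ {m ℓ f} {v : Vec Carrier (suc m)} → PolyFun m ℓ f → Descending v → Alternating f v →
                  ∃[ w ] v ⋗ w × FactorsOver {m} ℓ f w
  roots-between {zero} {v = ρ ∷ []} (constant f≈ℓ) _ _ = [] , ([] ∷ []) , λ x → trans (f≈ℓ x) (sym (*-identityʳ _))
  roots-between {suc m} {v = ρ ∷ ρ′ ∷ v} p desc@(_ ∷ desc′) alt =
    let g , q , alt′ , extend = split-root p desc alt
        w , v⋗w , g≈ = roots-between q desc′ alt′
    in extend w v⋗w g≈

  -- With one point fewer, the last root is that of a linear factor; it lies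
  -- below all points because the leading coefficient is positive.
  roots-below : ∀ {m ℓ f} {v : Vec Carrier m} → 0# < ℓ → PolyFun m ℓ f → Descending v → Alternating f v →
                ∃[ w ] v ⋗ w × FactorsOver {m} ℓ f w
  roots-below {zero} {v = []} _ (constant f≈ℓ) _ _ = [] , [] , λ x → trans (f≈ℓ x) (sym (*-identityʳ _))
  roots-below {suc zero} {ℓ} {f} {v = ρ ∷ []} 0<ℓ (horner c g (constant g≈ℓ) f≈) _ (0<fρ , _) with divide 0<ℓ (- c)
  ... | τ , τℓ≈-c , _ = τ ∷ [] , ((τ<ρ ∷ []) ∷ ([] ∷ [])) , linear
    where
    linear : ∀ x → f x ≈ ℓ * ((x - τ) * 1#)
    linear x = trans (f≈ x) (trans (+-cong (solve 1 (λ c → c := :- :- c) refl c) (*-congˡ (g≈ℓ x)))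
      (trans (+-congʳ (-‿cong (sym τℓ≈-c)))
        (solve 3 (λ x t l → :- (t :* l) :+ x :* l := l :* ((x :- t) :* con (+ 1))) refl x τ ℓ)))

    τ<ρ : τ < ρ
    τ<ρ = 0<-⇒< (*-cancel-0< 0<ℓ (<-respʳ-≈ (trans (linear ρ) (*-congˡ (*-identityʳ _))) 0<fρ))
  roots-below {suc (suc m)} {v = ρ ∷ ρ′ ∷ v} 0<ℓ p desc@(_ ∷ desc′) alt =
    let g , q , alt′ , extend = split-root p desc alt
        w , v⋗w , g≈ = roots-below 0<ℓ q desc′ alt′
    in extend w v⋗w g≈

  abstract
    -- The weight at the largest point is `f ρ / ∏ v ρ`, with positive numerator and denominator.
    -- Subtracting `c * ∏ v x` changes nothing on `v` and creates a zero at `ρ`; dividing by `x - ρ`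
    -- flips the signs on `v`, so the remaining weights are positive too.
    interpolate : ∀ {m ℓ f} {v : Vec Carrier (suc m)} → PolyFun m ℓ f → Descending v → Alternating f v →
                  ∃[ w ] All (0# <_) w × (∀ x → f x ≈ lagrange v w x)
    interpolate {ℓ = ℓ} {v = ρ ∷ []} (constant f≈ℓ) _ (0<fρ , _) = ℓ ∷ [] , <-respʳ-≈ (f≈ℓ ρ) 0<fρ ∷ [] , λ x →
      trans (f≈ℓ x) (solve 2 (λ l d → l := l :* con (+ 1) :+ d :* con (+ 0)) refl ℓ (x - ρ))
    interpolate {suc m} {ℓ} {f} {ρ ∷ v} p (v<ρ ∷ desc) (0<fρ , alt) with divide (∏-positive v<ρ) (f ρ)
    ... | c , c∏≈fρ , 0<c with factor ρ (PolyFun-+ p (PolyFun-scale (- c) (∏-PolyFun v)))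
    ... | h , q , f-c∏≈ = done (interpolate q desc (Alternating-⇛ (negative-factor-⇛ v<ρ
            (All.map (λ {x} ∏≈0 → trans (f≈ x) (trans (+-congʳ (trans (*-congˡ ∏≈0) (zeroʳ c))) (+-identityˡ _)))
              (∏-zeros v))) alt))
      where
      f≈ : ∀ x → f x ≈ c * ∏ v x + (x - ρ) * h x
      f≈ x = trans (solve 3 (λ y c p → y := c :* p :+ (y :+ (:- c) :* p)) refl (f x) c (∏ v x))
        (+-congˡ (trans (f-c∏≈ x) (trans (+-congʳ (trans (+-congʳ (sym c∏≈fρ))
          (solve 2 (λ c p → c :* p :+ (:- c) :* p := con (+ 0)) refl c (∏ v ρ)))) (+-identityˡ _))))

      done : ∃[ w ] All (0# <_) w × (∀ x → h x ≈ lagrange v w x) →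
             ∃[ w ] All (0# <_) w × (∀ x → f x ≈ lagrange (ρ ∷ v) w x)
      done (w , 0<w , h≈) = c ∷ w , 0<c 0<fρ ∷ 0<w , λ x → trans (f≈ x) (+-congˡ (*-congˡ (h≈ x)))

  -- Positivity of the Wronskian.

  -- With u(t) = ∏ v (-t²) and u₁(t) = t lagrange v w (-t²), this is the
  -- Wronskian u u₁′ - u′ u₁ at y = -t².
  wronskian : ∀ {n} → Vec Carrier n → Vec Carrier n → Carrier → Carrier
  wronskian v w y = lagrange v w y * ∏ v y + fromℕ 2 * y * (lagrange′ v w y * ∏ v y - ∏′ v y * lagrange v w y)

  -- Put `e = y - ρ`. The factor `e` common to `u` and the old part of `u₁` contributes `e²`. The
  -- new part `c t u` of `u₁` contributes `c u²` times the Wronskian of `e` and `t`, which is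
  -- `y - ρ + 2 t² = - y - ρ`.
  wronskian-∷ : ∀ {n} ρ c (v w : Vec Carrier n) y → wronskian (ρ ∷ v) (c ∷ w) y
                ≈ (y - ρ) * (y - ρ) * wronskian v w y + c * (- y - ρ) * (∏ v y * ∏ v y)
  wronskian-∷ ρ c v w y = solve 7 (λ r c y p p′ g g′ →
      (c :* p :+ (y :- r) :* g) :* ((y :- r) :* p) :+ con (+ 2) :* y :*
        ((c :* p′ :+ (g :+ (y :- r) :* g′)) :* ((y :- r) :* p) :- (p :+ (y :- r) :* p′) :* (c :* p :+ (y :- r) :* g))
      := (y :- r) :* (y :- r) :* (g :* p :+ con (+ 2) :* y :* (g′ :* p :- p′ :* g)) :+ c :* (:- y :- r) :* (p :* p))
    refl ρ c y (∏ v y) (∏′ v y) (lagrange v w y) (lagrange′ v w y)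

  0<-y-ρ : ∀ {y ρ} → y < 0# → ρ ≤ 0# → 0# < - y - ρ
  0<-y-ρ {y} {ρ} y<0 ρ≤0 = <-respʳ-≈ (+-congˡ (+-identityˡ (- ρ))) (0<+0≤ (<0⇒0<- y<0) (≤⇒0≤- ρ≤0))

  wronskian-nonneg : ∀ {n y} {v w : Vec Carrier n} → y < 0# → All (_≤ 0#) v → All (0# <_) w →
                     0# ≤ wronskian v w y
  wronskian-nonneg {y = y} {[]} {[]} _ [] [] = inj₂ (solve 1 (λ y → con (+ 0) := con (+ 0) :* con (+ 1) :+
      con (+ 2) :* y :* (con (+ 0) :* con (+ 1) :- con (+ 0) :* con (+ 0))) refl y)
  wronskian-nonneg {y = y} {ρ ∷ v} {c ∷ w} y<0 (ρ≤0 ∷ v≤0) (0<c ∷ 0<w) =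
    ≤-respʳ-≈ (sym (wronskian-∷ ρ c v w y)) (0≤+0≤ (0≤*0≤ (0≤x² _) (wronskian-nonneg y<0 v≤0 0<w))
      (0≤*0≤ (inj₁ (*-pos 0<c (0<-y-ρ y<0 ρ≤0))) (0≤x² _)))

  -- One strict term is enough: the weight at the head has the nonzero square `∏ v y * ∏ v y` as a
  -- factor, and the rest is nonnegative.
  wronskian-positive : ∀ {n y} {v w : Vec Carrier (suc n)} → y < 0# → All (_≤ 0#) v → All (0# <_) w →
                       ¬ (∏ v y ≈ 0#) → 0# < wronskian v w y
  wronskian-positive {y = y} {ρ ∷ v} {c ∷ w} y<0 (ρ≤0 ∷ v≤0) (0<c ∷ 0<w) ∏≉0 =
    <-respʳ-≈ (trans (solve 2 (λ x y → x :+ y := y :+ x) refl _ _) (sym (wronskian-∷ ρ c v w y)))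
      (0<+0≤ (*-pos (*-pos 0<c (0<-y-ρ y<0 ρ≤0)) (x≉0⇒0<x² (λ ∏≈0 → ∏≉0 (trans (*-congˡ ∏≈0) (zeroʳ _)))))
        (0≤*0≤ (0≤x² _) (wronskian-nonneg y<0 v≤0 0<w)))

  -- Coefficients of sums, products and derivatives.

  coeff-+ : ∀ p q k → coeff (p +ₚ q) k ≈ coeff p k + coeff q k
  coeff-+ []      q       k       = sym (+-identityˡ _)
  coeff-+ (a ∷ p) []      k       = sym (+-identityʳ _)
  coeff-+ (a ∷ p) (b ∷ q) zero    = refl
  coeff-+ (a ∷ p) (b ∷ q) (suc k) = coeff-+ p q k

  coeff-∙ : ∀ c p k → coeff (c ∙ₚ p) k ≈ c * coeff p k
  coeff-∙ c []      k       = sym (zeroʳ c)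
  coeff-∙ c (a ∷ p) zero    = refl
  coeff-∙ c (a ∷ p) (suc k) = coeff-∙ c p k

  coeff-X*-zero : ∀ p → coeff (X *ₚ p) 0 ≈ 0#
  coeff-X*-zero []      = refl
  coeff-X*-zero (a ∷ p) = trans (+-identityʳ _) (zeroˡ a)

  coeff-X*-suc : ∀ p k → coeff (X *ₚ p) (suc k) ≈ coeff p k
  coeff-X*-suc p k = trans (coeff-+ (0# ∙ₚ p) (0# ∷ (1# ∙ₚ p +ₚ (0# ∷ []))) (suc k))
    (trans (+-cong (trans (coeff-∙ 0# p (suc k)) (zeroˡ _))
      (trans (coeff-+ (1# ∙ₚ p) (0# ∷ []) k) (+-cong (trans (coeff-∙ 1# p k) (*-identityˡ _)) (coeff-0 k))))
      (trans (+-identityˡ _) (+-identityʳ _)))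
    where
    coeff-0 : ∀ k → coeff (0# ∷ []) k ≈ 0#
    coeff-0 zero    = refl
    coeff-0 (suc k) = refl

  mutual
    -- The function local to derivative has no name in scope.  It is found by
    -- unification in derivative-∷∷, where the with makes all its arguments
    -- distinct variables; the first two stand for the context it is defined in.
    weighted : Carrier → Poly → ℕ → Poly → Poly
    weighted = _

    derivative-∷∷ : ∀ a b p → derivative (a ∷ b ∷ p) ≡ fromℕ 1 * b ∷ weighted a (b ∷ p) 2 p
    derivative-∷∷ a b p with 2 | b ∷ p
    ... | k | bp = ≡.refl

  coeff-weighted : ∀ a p i q k → coeff (weighted a p i q) k ≈ fromℕ (i ℕ.+ k) * coeff q k
  coeff-weighted a p i []      k       = sym (zeroʳ _)
  coeff-weighted a p i (b ∷ q) zero    = *-congʳ (fromℕ-cong (≡.sym (ℕ.+-identityʳ i)))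
  coeff-weighted a p i (b ∷ q) (suc k) =
    trans (coeff-weighted a p (suc i) q k) (*-congʳ (fromℕ-cong (≡.sym (ℕ.+-suc i k))))

  coeff-X*derivative : ∀ p k → coeff (X *ₚ derivative p) k ≈ fromℕ k * coeff p k
  coeff-X*derivative p zero          = trans (coeff-X*-zero (derivative p)) (sym (zeroˡ _))
  coeff-X*derivative p (suc k)       = trans (coeff-X*-suc (derivative p) k) (coeff-derivative p k)
    where
    coeff-derivative : ∀ p k → coeff (derivative p) k ≈ fromℕ (suc k) * coeff p (suc k)
    coeff-derivative []      k = sym (zeroʳ _)
    coeff-derivative (a ∷ p) k = coeff-weighted a p 1 p k

  -- Evaluation of polynomials.

  -- A codomain for evaluation. The real numbers and the complex numbers are the two instances, so
  -- the homomorphism laws are proved once for both.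
  record RealAlgebra : Set₁ where
    field
      ring : CommutativeRing 0ℓ 0ℓ

    module S = CommutativeRing ring

    field
      φ      : Carrier → S.Carrier
      φ-cong : ∀ {a b} → a ≈ b → φ a S.≈ φ b
      φ-0    : φ 0# S.≈ S.0#
      φ-1    : φ 1# S.≈ S.1#
      φ-+    : ∀ a b → φ (a + b) S.≈ φ a S.+ φ b
      φ-*    : ∀ a b → φ (a * b) S.≈ φ a S.* φ b

  module Eval (algebra : RealAlgebra) where

    open RealAlgebra algebra

    module S-Solver = IntegerSolver ring
    open S-Solver using () renaming (solve to solveₛ; _:=_ to _:=ₛ_; _:+_ to _:+ₛ_; _:*_ to _:*ₛ_; con to conₛ)

    eval : Poly → S.Carrier → S.Carrier
    eval p z = foldr (λ a w → φ a S.+ (z S.* w)) S.0# p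

    eval-≈0 : ∀ p {z} → (∀ k → coeff p k ≈ 0#) → eval p z S.≈ S.0#
    eval-≈0 []      p≈0 = S.refl
    eval-≈0 (a ∷ p) p≈0 = S.trans (S.+-cong (S.trans (φ-cong (p≈0 0)) φ-0)
      (S.*-congˡ (eval-≈0 p λ k → p≈0 (suc k)))) (S.trans (S.+-identityˡ _) (S.zeroʳ _))

    eval-cong : ∀ p q {z} → p ≈ₚ q → eval p z S.≈ eval q z
    eval-cong []      q       p≈q = S.sym (eval-≈0 q λ k → sym (p≈q k))
    eval-cong (a ∷ p) []      p≈q = eval-≈0 (a ∷ p) p≈q
    eval-cong (a ∷ p) (b ∷ q) p≈q =
      S.+-cong (φ-cong (p≈q 0)) (S.*-congˡ (eval-cong p q λ k → p≈q (suc k)))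

    eval-resp : ∀ p {z w} → z S.≈ w → eval p z S.≈ eval p w
    eval-resp []      z≈w = S.refl
    eval-resp (a ∷ p) z≈w = S.+-congˡ (S.*-cong z≈w (eval-resp p z≈w))

    eval-+ : ∀ p q z → eval (p +ₚ q) z S.≈ eval p z S.+ eval q z
    eval-+ []      q       z = S.sym (S.+-identityˡ _)
    eval-+ (a ∷ p) []      z = S.sym (S.+-identityʳ _)
    eval-+ (a ∷ p) (b ∷ q) z = S.trans (S.+-cong (φ-+ a b) (S.*-congˡ (eval-+ p q z)))
      (solveₛ 5 (λ a b z p q → a :+ₛ b :+ₛ z :*ₛ (p :+ₛ q) :=ₛ a :+ₛ z :*ₛ p :+ₛ (b :+ₛ z :*ₛ q))
        S.refl (φ a) (φ b) z (eval p z) (eval q z))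

    eval-∙ : ∀ c p z → eval (c ∙ₚ p) z S.≈ φ c S.* eval p z
    eval-∙ c []      z = S.sym (S.zeroʳ _)
    eval-∙ c (a ∷ p) z = S.trans (S.+-cong (φ-* c a) (S.*-congˡ (eval-∙ c p z)))
      (solveₛ 4 (λ c a z p → c :*ₛ a :+ₛ z :*ₛ (c :*ₛ p) :=ₛ c :*ₛ (a :+ₛ z :*ₛ p))
        S.refl (φ c) (φ a) z (eval p z))

    eval-* : ∀ p q z → eval (p *ₚ q) z S.≈ eval p z S.* eval q z
    eval-* []      q z = S.sym (S.zeroˡ _)
    eval-* (a ∷ p) q z = S.trans (eval-+ (a ∙ₚ q) (0# ∷ p *ₚ q) z)
      (S.trans (S.+-cong (eval-∙ a q z) (S.+-cong φ-0 (S.*-congˡ (eval-* p q z))))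
        (solveₛ 4 (λ a z p q → a :*ₛ q :+ₛ (conₛ (+ 0) :+ₛ z :*ₛ (p :*ₛ q)) :=ₛ (a :+ₛ z :*ₛ p) :*ₛ q)
          S.refl (φ a) z (eval p z) (eval q z)))

    eval-constant : ∀ a z → eval (a ∷ []) z S.≈ φ a
    eval-constant a z = S.trans (S.+-congˡ (S.zeroʳ z)) (S.+-identityʳ _)

    eval-𝟏 : ∀ z → eval 𝟏 z S.≈ S.1#
    eval-𝟏 z = S.trans (eval-constant 1# z) φ-1

    eval-linear : ∀ a b z → eval (a ∷ b ∷ []) z S.≈ φ a S.+ φ b S.* z
    eval-linear a b z = solveₛ 3 (λ a b z → a :+ₛ z :*ₛ (b :+ₛ z :*ₛ conₛ (+ 0)) :=ₛ a :+ₛ b :*ₛ z) S.refl (φ a) (φ b) z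

    eval-X : ∀ z → eval X z S.≈ z
    eval-X z = S.trans (eval-linear 0# 1# z) (S.trans (S.+-cong φ-0 (S.*-congʳ φ-1))
      (solveₛ 1 (λ z → conₛ (+ 0) :+ₛ conₛ (+ 1) :*ₛ z :=ₛ z) S.refl z))

    eval-X* : ∀ p z → eval (X *ₚ p) z S.≈ z S.* eval p z
    eval-X* p z = S.trans (eval-* X p z) (S.*-congʳ (eval-X z))

    eval-substSquare : ∀ p z → eval (substSquare p) z S.≈ eval p (z S.* z)
    eval-substSquare []      z = S.refl
    eval-substSquare (a ∷ p) z = S.+-congˡ (S.trans (S.*-congˡ (S.+-cong φ-0 (S.*-congˡ (eval-substSquare p z))))
      (solveₛ 2 (λ z p → z :*ₛ (conₛ (+ 0) :+ₛ z :*ₛ p) :=ₛ z :*ₛ z :*ₛ p) S.refl z (eval p (z S.* z))))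

  ℝ-algebra : RealAlgebra
  ℝ-algebra = record
    { ring = commutativeRing ; φ = λ a → a ; φ-cong = λ a≈b → a≈b
    ; φ-0 = refl ; φ-1 = refl ; φ-+ = λ _ _ → refl ; φ-* = λ _ _ → refl }

  open Eval ℝ-algebra public

  -- The value of the derivative by the product rule on `a + x p`. It follows the list structure,
  -- whereas `derivative` carries a running weight, so Leibniz' rule becomes a plain induction.
  deriv : Poly → Carrier → Carrier
  deriv []      x = 0#
  deriv (a ∷ p) x = eval p x + x * deriv p x

  eval-derivative : ∀ p x → eval (derivative p) x ≈ deriv p x
  eval-derivative []      x = refl
  eval-derivative (a ∷ p) x = trans (eval-weighted 1 p)
    (+-congʳ (trans (*-congʳ (+-identityʳ 1#)) (*-identityˡ _)))
    where
    eval-weighted : ∀ i q → eval (weighted a p i q) x ≈ fromℕ i * eval q x + x * deriv q x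
    eval-weighted i []      = solve 2 (λ i x → con (+ 0) := i :* con (+ 0) :+ x :* con (+ 0)) refl (fromℕ i) x
    eval-weighted i (b ∷ q) = trans (+-congˡ (*-congˡ (eval-weighted (suc i) q)))
      (solve 5 (λ i b x q d → i :* b :+ x :* ((con (+ 1) :+ i) :* q :+ x :* d)
                 := i :* (b :+ x :* q) :+ x :* (q :+ x :* d)) refl (fromℕ i) b x (eval q x) (deriv q x))

  deriv-≈0 : ∀ p {x} → (∀ k → coeff p k ≈ 0#) → deriv p x ≈ 0#
  deriv-≈0 []      p≈0 = refl
  deriv-≈0 (a ∷ p) p≈0 = trans (+-cong (eval-≈0 p λ k → p≈0 (suc k)) (*-congˡ (deriv-≈0 p λ k → p≈0 (suc k))))
    (trans (+-identityˡ _) (zeroʳ _))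

  deriv-cong : ∀ p q {x} → p ≈ₚ q → deriv p x ≈ deriv q x
  deriv-cong []      q       p≈q = sym (deriv-≈0 q λ k → sym (p≈q k))
  deriv-cong (a ∷ p) []      p≈q = deriv-≈0 (a ∷ p) p≈q
  deriv-cong (a ∷ p) (b ∷ q) p≈q =
    +-cong (eval-cong p q λ k → p≈q (suc k)) (*-congˡ (deriv-cong p q λ k → p≈q (suc k)))

  deriv-+ : ∀ p q x → deriv (p +ₚ q) x ≈ deriv p x + deriv q x
  deriv-+ []      q       x = sym (+-identityˡ _)
  deriv-+ (a ∷ p) []      x = sym (+-identityʳ _)
  deriv-+ (a ∷ p) (b ∷ q) x = trans (+-cong (eval-+ p q x) (*-congˡ (deriv-+ p q x)))
    (solve 5 (λ p q x d e → p :+ q :+ x :* (d :+ e) := p :+ x :* d :+ (q :+ x :* e))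
      refl (eval p x) (eval q x) x (deriv p x) (deriv q x))

  deriv-∙ : ∀ c p x → deriv (c ∙ₚ p) x ≈ c * deriv p x
  deriv-∙ c []      x = sym (zeroʳ c)
  deriv-∙ c (a ∷ p) x = trans (+-cong (eval-∙ c p x) (*-congˡ (deriv-∙ c p x)))
    (solve 4 (λ c p x d → c :* p :+ x :* (c :* d) := c :* (p :+ x :* d)) refl c (eval p x) x (deriv p x))

  deriv-* : ∀ p q x → deriv (p *ₚ q) x ≈ deriv p x * eval q x + eval p x * deriv q x
  deriv-* []      q x = solve 2 (λ q d → con (+ 0) := con (+ 0) :* q :+ con (+ 0) :* d) refl (eval q x) (deriv q x)
  deriv-* (a ∷ p) q x = trans (deriv-+ (a ∙ₚ q) (0# ∷ p *ₚ q) x)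
    (trans (+-cong (deriv-∙ a q x) (+-cong (eval-* p q x) (*-congˡ (deriv-* p q x))))
      (solve 6 (λ a x p d q e → a :* e :+ (p :* q :+ x :* (d :* q :+ p :* e))
                 := (p :+ x :* d) :* q :+ (a :+ x :* p) :* e) refl a x (eval p x) (deriv p x) (eval q x) (deriv q x)))

  eval-PolyFun : ∀ {m} p → DegreeAtMost m p → PolyFun m (coeff p m) (eval p)
  eval-PolyFun {zero}  []      _ = constant λ _ → refl
  eval-PolyFun {zero}  (a ∷ p) d = constant λ x →
    trans (+-congˡ (trans (*-congˡ (eval-≈0 p λ k → d (suc k) (s≤s z≤n))) (zeroʳ x))) (+-identityʳ a)
  eval-PolyFun {suc m} []      _ = horner 0# (λ _ → 0#) (eval-PolyFun {m} [] λ _ _ → refl)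
    λ x → sym (trans (+-identityˡ _) (zeroʳ x))
  eval-PolyFun {suc m} (a ∷ p) d = horner a (eval p) (eval-PolyFun p λ k m<k → d (suc k) (s≤s m<k)) λ _ → refl

  coeff-beyond-length : ∀ p k → length p ℕ.≤ k → coeff p k ≈ 0#
  coeff-beyond-length []      k       _       = refl
  coeff-beyond-length (a ∷ p) (suc k) (s≤s l) = coeff-beyond-length p k l

  -- The value at 0 kills the constant term, and then `x * eval p x ≈ 0#` makes the tail vanish away
  -- from 0. At 0 it vanishes by continuity: a nonzero value would persist at some `δ > 0`.
  vanishing-coeffs : ∀ p → (∀ x → eval p x ≈ 0#) → ∀ k → coeff p k ≈ 0#
  vanishing-coeffs []      _   k = refl
  vanishing-coeffs (a ∷ p) f≈0 = λ where
      zero    → a≈0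
      (suc k) → vanishing-coeffs p p≈0 k
    where
    a≈0 : a ≈ 0#
    a≈0 = trans (sym (trans (+-congˡ (zeroˡ _)) (+-identityʳ a))) (f≈0 0#)

    x*p≈0 : ∀ x → x * eval p x ≈ 0#
    x*p≈0 x = trans (sym (trans (+-congʳ a≈0) (+-identityˡ _))) (f≈0 x)

    P : PolyFun (length p) (coeff p (length p)) (eval p)
    P = eval-PolyFun p λ k l<k → coeff-beyond-length p k (ℕ.<⇒≤ l<k)

    at-δ : ∀ {δ} → 0# < δ → ∣ δ - 0# ∣≤ δ × eval p δ ≈ 0#
    at-δ {δ} 0<δ = ( inj₂ (solve 1 (λ d → con (+ 0) := d :- (d :- con (+ 0))) refl δ)
                   , ≤-respʳ-≈ (solve 1 (λ d → d :+ d := d :+ (d :- con (+ 0))) refl δ) (inj₁ (0<+0< 0<δ 0<δ)))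
                 , *-cancel-≈0 (0<⇒≉0 0<δ) (x*p≈0 δ)

    p≈0 : ∀ x → eval p x ≈ 0#
    p≈0 x with compare x 0#
    ... | tri< _ x≉0 _ = *-cancel-≈0 x≉0 (x*p≈0 x)
    ... | tri> _ x≉0 _ = *-cancel-≈0 x≉0 (x*p≈0 x)
    ... | tri≈ _ x≈0 _ with compare (eval p 0#) 0#
    ... | tri≈ _ p0≈0 _ = trans (eval-resp p x≈0) p0≈0
    ... | tri< p0<0 _ _ = let δ , 0<δ , p<0 = locally-negative P 0# p0<0 in
          contradiction (p<0 δ (proj₁ (at-δ 0<δ))) (irrefl (proj₂ (at-δ 0<δ)))
    ... | tri> _ _ 0<p0 = let δ , 0<δ , 0<p = locally-positive P 0# 0<p0 in
          contradiction (0<p δ (proj₁ (at-δ 0<δ))) (irrefl (sym (proj₂ (at-δ 0<δ))))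

  -- Turns an identity of coefficient lists into one at a generic point, where the ring solver
  -- applies.
  eval-injective : ∀ p q → (∀ x → eval p x ≈ eval q x) → p ≈ₚ q
  eval-injective p q p≈q k = trans
    (solve 2 (λ a b → a := a :+ (:- con (+ 1)) :* b :+ b) refl (coeff p k) (coeff q k))
    (trans (+-congʳ (trans (+-congˡ (sym (coeff-∙ (- 1#) q k))) (trans (sym (coeff-+ p (- 1# ∙ₚ q) k))
      (vanishing-coeffs (p +ₚ - 1# ∙ₚ q) (λ x → trans (eval-+ p (- 1# ∙ₚ q) x)
        (trans (+-cong (p≈q x) (eval-∙ (- 1#) q x))
          (solve 1 (λ a → a :+ (:- con (+ 1)) :* a := con (+ 0)) refl (eval q x)))) k))))
      (+-identityˡ _))

  -- The recurrences for values and for coefficients.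

  fromℕ-2* : ∀ n → fromℕ (2 ℕ.* n) ≈ fromℕ 2 * fromℕ n
  fromℕ-2* = fromℕ-* 2

  fromℕ-2*+1 : ∀ n → fromℕ (2 ℕ.* n ℕ.+ 1) ≈ fromℕ 2 * fromℕ n + 1#
  fromℕ-2*+1 n = trans (fromℕ-+ (2 ℕ.* n) 1) (+-cong (fromℕ-2* n) (+-identityʳ 1#))

  eval-2X[1-X]* : ∀ p x → eval ((fromℕ 2 ∙ₚ X) *ₚ (1# ∷ - 1# ∷ []) *ₚ p) x ≈ fromℕ 2 * x * (1# - x) * eval p x
  eval-2X[1-X]* p x = trans (eval-* ((fromℕ 2 ∙ₚ X) *ₚ (1# ∷ - 1# ∷ [])) p x) (*-congʳ
    (trans (eval-* (fromℕ 2 ∙ₚ X) (1# ∷ - 1# ∷ []) x)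
      (*-cong (trans (eval-∙ (fromℕ 2) X x) (*-congˡ (eval-X x)))
        (trans (eval-linear 1# (- 1#) x)
          (solve 1 (λ x → con (+ 1) :+ (:- con (+ 1)) :* x := con (+ 1) :- x) refl x)))))

  eval-M-suc : ∀ n x → eval (M (suc n)) x ≈
    (fromℕ 2 * fromℕ n * x + 1#) * eval (M n) x + fromℕ 2 * x * (1# - x) * deriv (M n) x
  eval-M-suc n x = trans (eval-+ ((fromℕ (2 ℕ.* n) ∙ₚ X +ₚ 𝟏) *ₚ M n) _ x)
    (+-cong (trans (eval-* (fromℕ (2 ℕ.* n) ∙ₚ X +ₚ 𝟏) (M n) x) (*-congʳ
        (trans (eval-+ (fromℕ (2 ℕ.* n) ∙ₚ X) 𝟏 x) (+-cong
          (trans (eval-∙ (fromℕ (2 ℕ.* n)) X x) (*-cong (fromℕ-2* n) (eval-X x))) (eval-𝟏 x)))))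
      (trans (eval-2X[1-X]* (derivative (M n)) x) (*-congˡ (eval-derivative (M n) x))))

  eval-M̃-suc : ∀ n x → eval (M̃ (suc n)) x ≈
    (fromℕ 2 * fromℕ n + 1#) * x * eval (M̃ n) x + fromℕ 2 * x * (1# - x) * deriv (M̃ n) x
  eval-M̃-suc n x = trans (eval-+ ((fromℕ (2 ℕ.* n ℕ.+ 1) ∙ₚ X) *ₚ M̃ n) _ x)
    (+-cong (trans (eval-* (fromℕ (2 ℕ.* n ℕ.+ 1) ∙ₚ X) (M̃ n) x) (*-congʳ
        (trans (eval-∙ (fromℕ (2 ℕ.* n ℕ.+ 1)) X x) (*-cong (fromℕ-2*+1 n) (eval-X x)))))
      (trans (eval-2X[1-X]* (derivative (M̃ n)) x) (*-congˡ (eval-derivative (M̃ n) x))))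

  -- The operator `c p + 2 (1 - x) p′` behind both recurrences: `M` grows by `x` times it with
  -- `c = 2n`, and `M̃` becomes `x` times it with `c = 2n + 1`.
  step : Carrier → Poly → Poly
  step c p = c ∙ₚ p +ₚ fromℕ 2 ∙ₚ (derivative p +ₚ - 1# ∙ₚ (X *ₚ derivative p))

  eval-step : ∀ c p x → eval (step c p) x ≈ c * eval p x + fromℕ 2 * (1# - x) * deriv p x
  eval-step c p x = trans (eval-+ (c ∙ₚ p) _ x) (+-cong (eval-∙ c p x)
    (trans (eval-∙ (fromℕ 2) (derivative p +ₚ - 1# ∙ₚ (X *ₚ derivative p)) x)
      (trans (*-congˡ (trans (eval-+ (derivative p) _ x) (+-cong (eval-derivative p x)
          (trans (eval-∙ (- 1#) (X *ₚ derivative p) x) (*-congˡ (trans (eval-X* (derivative p) x)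
            (*-congˡ (eval-derivative p x))))))))
        (solve 2 (λ x d → con (+ 2) :* (d :+ (:- con (+ 1)) :* (x :* d)) := con (+ 2) :* (con (+ 1) :- x) :* d)
          refl x (deriv p x)))))

  coeff-step : ∀ c p k → coeff (step c p) k ≈
    c * coeff p k + fromℕ 2 * (fromℕ (suc k) * coeff p (suc k) - fromℕ k * coeff p k)
  coeff-step c p k = trans (coeff-+ (c ∙ₚ p) _ k) (+-cong (coeff-∙ c p k)
    (trans (coeff-∙ (fromℕ 2) (derivative p +ₚ - 1# ∙ₚ (X *ₚ derivative p)) k) (*-congˡ
      (trans (coeff-+ (derivative p) _ k) (+-cong
        (trans (sym (coeff-X*-suc (derivative p) k)) (coeff-X*derivative p (suc k)))
        (trans (coeff-∙ (- 1#) (X *ₚ derivative p) k) (trans (*-congˡ (coeff-X*derivative p k))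
          (solve 1 (λ y → (:- con (+ 1)) :* y := :- y) refl (fromℕ k * coeff p k)))))))))

  M-suc : ∀ n → M (suc n) ≈ₚ M n +ₚ X *ₚ step (fromℕ 2 * fromℕ n) (M n)
  M-suc n = eval-injective (M (suc n)) (M n +ₚ X *ₚ step (fromℕ 2 * fromℕ n) (M n)) λ x →
    trans (eval-M-suc n x) (sym (trans (eval-+ (M n) _ x)
      (trans (+-congˡ (trans (eval-X* (step (fromℕ 2 * fromℕ n) (M n)) x) (*-congˡ (eval-step _ (M n) x))))
        (solve 4 (λ n x m d → m :+ x :* (con (+ 2) :* n :* m :+ con (+ 2) :* (con (+ 1) :- x) :* d)
          := (con (+ 2) :* n :* x :+ con (+ 1)) :* m :+ con (+ 2) :* x :* (con (+ 1) :- x) :* d)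
          refl (fromℕ n) x (eval (M n) x) (deriv (M n) x)))))

  M̃-suc : ∀ n → M̃ (suc n) ≈ₚ X *ₚ step (fromℕ 2 * fromℕ n + 1#) (M̃ n)
  M̃-suc n = eval-injective (M̃ (suc n)) (X *ₚ step (fromℕ 2 * fromℕ n + 1#) (M̃ n)) λ x →
    trans (eval-M̃-suc n x) (sym (trans (eval-X* (step (fromℕ 2 * fromℕ n + 1#) (M̃ n)) x)
      (trans (*-congˡ (eval-step _ (M̃ n) x))
        (solve 4 (λ n x m d → x :* ((con (+ 2) :* n :+ con (+ 1)) :* m :+ con (+ 2) :* (con (+ 1) :- x) :* d)
          := (con (+ 2) :* n :+ con (+ 1)) :* x :* m :+ con (+ 2) :* x :* (con (+ 1) :- x) :* d)
          refl (fromℕ n) x (eval (M̃ n) x) (deriv (M̃ n) x)))))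

  p q : ℕ → ℕ → Carrier
  p n k = coeff (M̃ n) k
  q n k = coeff (M n) k

  q-zero : ∀ n → q n 0 ≈ 1#
  q-zero zero    = refl
  q-zero (suc n) = trans (M-suc n 0) (trans (coeff-+ (M n) _ 0)
    (trans (+-congˡ (coeff-X*-zero (step (fromℕ 2 * fromℕ n) (M n)))) (trans (+-identityʳ _) (q-zero n))))

  q-suc : ∀ n k → q (suc n) (suc k) ≈ q n (suc k) +
    (fromℕ 2 * fromℕ n * q n k + fromℕ 2 * (fromℕ (suc k) * q n (suc k) - fromℕ k * q n k))
  q-suc n k = trans (M-suc n (suc k)) (trans (coeff-+ (M n) _ (suc k)) (+-congˡ
    (trans (coeff-X*-suc (step (fromℕ 2 * fromℕ n) (M n)) k) (coeff-step _ (M n) k))))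

  p-zero : ∀ n → p (suc n) 0 ≈ 0#
  p-zero n = trans (M̃-suc n 0) (coeff-X*-zero (step (fromℕ 2 * fromℕ n + 1#) (M̃ n)))

  p-suc : ∀ n k → p (suc n) (suc k) ≈
    (fromℕ 2 * fromℕ n + 1#) * p n k + fromℕ 2 * (fromℕ (suc k) * p n (suc k) - fromℕ k * p n k)
  p-suc n k = trans (M̃-suc n (suc k)) (trans (coeff-X*-suc (step (fromℕ 2 * fromℕ n + 1#) (M̃ n)) k) (coeff-step _ (M̃ n) k))

  -- Even and odd part of `T`, and the reversal of coefficients.

  -- T_{n,2}(x) = Σₖ α n k x²ᵏ + x Σₖ β n k x²ᵏ; the recurrences come from
  -- T_{n+1} = (x + 2n x²) T_n + x (1 - x²) T_n′.
  α β : ℕ → ℕ → Carrier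
  α zero    zero    = 1#
  α zero    (suc k) = 0#
  α (suc n) zero    = 0#
  α (suc n) (suc k) = fromℕ 2 * (fromℕ n - fromℕ k) * α n k + fromℕ 2 * fromℕ (suc k) * α n (suc k) + β n k
  β zero    k       = 0#
  β (suc n) zero    = β n 0 + α n 0
  β (suc n) (suc k) = (fromℕ 2 * (fromℕ n - fromℕ k) - 1#) * β n k + (fromℕ 2 * fromℕ (suc k) + 1#) * β n (suc k)
                      + α n (suc k)

  -- The recurrences of `α` and `β` at the same index add up to that of `M`. Shifting `β` by one
  -- index gives that of `M̃` in the same way, see `p-suc≈α+β`.
  q≈α+β : ∀ n k → q n k ≈ α n k + β n k
  q≈α+β zero    zero    = sym (+-identityʳ 1#)
  q≈α+β zero    (suc k) = sym (+-identityʳ 0#)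
  q≈α+β (suc n) zero    = trans (q-zero (suc n)) (trans (sym (q-zero n)) (trans (q≈α+β n 0)
    (solve 2 (λ a b → a :+ b := con (+ 0) :+ (b :+ a)) refl (α n 0) (β n 0))))
  q≈α+β (suc n) (suc k) = trans (q-suc n k)
    (trans (+-cong (q≈α+β n (suc k)) (+-cong (*-congˡ (q≈α+β n k))
        (*-congˡ (+-cong (*-congˡ (q≈α+β n (suc k))) (-‿cong (*-congˡ (q≈α+β n k)))))))
      (solve 6 (λ n k a a′ b b′ → a′ :+ b′ :+ (con (+ 2) :* n :* (a :+ b) :+
            con (+ 2) :* ((con (+ 1) :+ k) :* (a′ :+ b′) :- k :* (a :+ b)))
          := con (+ 2) :* (n :- k) :* a :+ con (+ 2) :* (con (+ 1) :+ k) :* a′ :+ b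
             :+ ((con (+ 2) :* (n :- k) :- con (+ 1)) :* b :+ (con (+ 2) :* (con (+ 1) :+ k) :+ con (+ 1)) :* b′ :+ a′))
        refl (fromℕ n) (fromℕ k) (α n k) (α n (suc k)) (β n k) (β n (suc k))))

  p-zero≈α : ∀ n → p n 0 ≈ α n 0
  p-zero≈α zero    = refl
  p-zero≈α (suc n) = p-zero n

  p-suc≈α+β : ∀ n k → p n (suc k) ≈ α n (suc k) + β n k
  p-suc≈α+β zero    k       = sym (+-identityʳ 0#)
  p-suc≈α+β (suc n) zero    = trans (p-suc n 0)
    (trans (+-cong (*-congˡ (p-zero≈α n)) (*-congˡ (+-cong (*-congˡ (p-suc≈α+β n 0)) (-‿cong (zeroˡ _)))))
      (solve 4 (λ n a a′ b → (con (+ 2) :* n :+ con (+ 1)) :* a :+ con (+ 2) :* ((con (+ 1) :+ con (+ 0)) :* (a′ :+ b) :- con (+ 0))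
          := con (+ 2) :* (n :- con (+ 0)) :* a :+ con (+ 2) :* (con (+ 1) :+ con (+ 0)) :* a′ :+ b :+ (b :+ a))
        refl (fromℕ n) (α n 0) (α n 1) (β n 0)))
  p-suc≈α+β (suc n) (suc k) = trans (p-suc n (suc k))
    (trans (+-cong (*-congˡ (p-suc≈α+β n k)) (*-congˡ (+-cong (*-congˡ (p-suc≈α+β n (suc k)))
        (-‿cong (*-congˡ (p-suc≈α+β n k))))))
      (solve 6 (λ n k a a′ b b′ → (con (+ 2) :* n :+ con (+ 1)) :* (a :+ b) :+
            con (+ 2) :* ((con (+ 1) :+ (con (+ 1) :+ k)) :* (a′ :+ b′) :- (con (+ 1) :+ k) :* (a :+ b))
          := con (+ 2) :* (n :- (con (+ 1) :+ k)) :* a :+ con (+ 2) :* (con (+ 1) :+ (con (+ 1) :+ k)) :* a′ :+ b′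
             :+ ((con (+ 2) :* (n :- k) :- con (+ 1)) :* b :+ (con (+ 2) :* (con (+ 1) :+ k) :+ con (+ 1)) :* b′ :+ a))
        refl (fromℕ n) (fromℕ k) (α n (suc k)) (α n (suc (suc k))) (β n k) (β n (suc k))))

  vanish₃ : ∀ {x y z} a b → x ≈ 0# → y ≈ 0# → z ≈ 0# → a * x + b * y + z ≈ 0#
  vanish₃ a b x≈0 y≈0 z≈0 = trans (+-cong (+-cong (*-congˡ x≈0) (*-congˡ y≈0)) z≈0)
    (solve 2 (λ a b → a :* con (+ 0) :+ b :* con (+ 0) :+ con (+ 0) := con (+ 0)) refl a b)

  mutual
    α-beyond : ∀ n k → n ℕ.< k → α n k ≈ 0#
    α-beyond zero    (suc k) _         = refl
    α-beyond (suc n) (suc k) (s≤s n<k) =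
      vanish₃ _ _ (α-beyond n k n<k) (α-beyond n (suc k) (ℕ.m<n⇒m<1+n n<k)) (β-beyond n k (ℕ.<⇒≤ n<k))

    β-beyond : ∀ n k → n ℕ.≤ k → β n k ≈ 0#
    β-beyond zero    k       _         = refl
    β-beyond (suc n) (suc k) (s≤s n≤k) =
      vanish₃ _ _ (β-beyond n k n≤k) (β-beyond n (suc k) (ℕ.m≤n⇒m≤1+n n≤k)) (α-beyond n (suc k) (s≤s n≤k))

  α-top : ∀ n → α (suc n) (suc n) ≈ 0#
  α-top n = trans (+-cong (+-cong (*-congʳ (*-congˡ (-‿inverseʳ (fromℕ n)))) (*-congˡ (α-beyond n (suc n) ℕ.≤-refl)))
      (β-beyond n n ℕ.≤-refl))
    (solve 2 (λ a c → con (+ 2) :* con (+ 0) :* a :+ c :* con (+ 0) :+ con (+ 0) := con (+ 0)) refl (α n n) (fromℕ 2 * fromℕ (suc n)))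

  β-top : ∀ n → β (suc (suc n)) (suc n) ≈ β (suc n) n + α (suc n) (suc n)
  β-top n = +-congʳ (trans (+-congˡ (*-congˡ (β-beyond (suc n) (suc n) ℕ.≤-refl)))
    (solve 3 (λ n b c → (con (+ 2) :* (con (+ 1) :+ n :- n) :- con (+ 1)) :* b :+ c :* con (+ 0) := b)
      refl (fromℕ n) (β (suc n) n) (fromℕ 2 * fromℕ (suc n) + 1#)))

  fromℕ-[1+i+j] : ∀ i j → fromℕ (suc (i ℕ.+ j)) ≈ 1# + (fromℕ i + fromℕ j)
  fromℕ-[1+i+j] i j = +-congˡ (fromℕ-+ i j)

  mutual
    -- Reversal preserves the recurrences. In row `suc n` with `n = i + j + 1`, the factor
    -- `2 (n - i)` equals `2 (j + 1)`, so exchanging `i` and `j` exchanges the first two terms; the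
    -- odd factors of `β` match likewise with `n = i + j + 2`. At the borders, `α-top` and `β-top`
    -- mirror the clauses for index `zero`.
    α-sym : ∀ n i j → i ℕ.+ j ≡ n → α n i ≈ α n j
    α-sym zero    zero    zero    _       = refl
    α-sym (suc n) zero    (suc j) ≡.refl  = sym (α-top n)
    α-sym (suc n) (suc i) zero    i+0≡n   =
      ≡.subst (λ k → α (suc n) k ≈ 0#) (≡.trans (≡.sym i+0≡n) (ℕ.+-identityʳ (suc i))) (α-top n)
    α-sym (suc n) (suc i) (suc j) i+1+j≡n with ≡.trans (≡.sym (ℕ.suc-injective i+1+j≡n)) (ℕ.+-suc i j)
    ... | ≡.refl = trans
      (+-cong (+-cong (*-cong (*-congˡ (+-congʳ (fromℕ-[1+i+j] i j))) (α-sym n i (suc j) (ℕ.+-suc i j)))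
        (*-congˡ (α-sym n (suc i) j ≡.refl))) (β-sym n i j ≡.refl))
      (trans (solve 5 (λ i j a a′ b → con (+ 2) :* (con (+ 1) :+ (i :+ j) :- i) :* a′ :+ con (+ 2) :* (con (+ 1) :+ i) :* a :+ b
          := con (+ 2) :* (con (+ 1) :+ (i :+ j) :- j) :* a :+ con (+ 2) :* (con (+ 1) :+ j) :* a′ :+ b)
          refl (fromℕ i) (fromℕ j) (α n j) (α n (suc j)) (β n j))
        (+-congʳ (+-congʳ (*-congʳ (*-congˡ (+-congʳ (sym (fromℕ-[1+i+j] i j))))))))

    β-sym : ∀ n i j → suc (i ℕ.+ j) ≡ n → β n i ≈ β n j
    β-sym (suc zero)    zero    zero    _      = refl
    β-sym (suc (suc n)) zero    (suc j) ≡.refl = sym (trans (β-top n)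
      (+-cong (β-sym (suc n) n 0 (≡.cong suc (ℕ.+-identityʳ n))) (α-sym (suc n) (suc n) 0 (≡.cong suc (ℕ.+-identityʳ n)))))
    β-sym (suc (suc n)) (suc i) zero    i+0≡n  =
      ≡.subst (λ k → β (suc (suc n)) k ≈ β (suc n) 0 + α (suc n) 0)
        (≡.sym (≡.trans (≡.sym (ℕ.+-identityʳ (suc i))) (ℕ.suc-injective i+0≡n)))
        (trans (β-top n) (+-cong (β-sym (suc n) n 0 (≡.cong suc (ℕ.+-identityʳ n)))
          (α-sym (suc n) (suc n) 0 (≡.cong suc (ℕ.+-identityʳ n)))))
    β-sym (suc n) (suc i) (suc j) i+1+j≡n with ≡.trans (≡.sym (ℕ.suc-injective i+1+j≡n)) (≡.cong suc (ℕ.+-suc i j))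
    ... | ≡.refl = trans
      (+-cong (+-cong (*-cong (+-congʳ (*-congˡ (+-congʳ (+-congˡ (fromℕ-[1+i+j] i j)))))
          (β-sym n i (suc j) (≡.cong suc (ℕ.+-suc i j))))
        (*-congˡ (β-sym n (suc i) j ≡.refl))) (α-sym n (suc i) (suc j) (≡.cong suc (ℕ.+-suc i j))))
      (trans (solve 5 (λ i j b b′ a →
            (con (+ 2) :* (con (+ 1) :+ (con (+ 1) :+ (i :+ j)) :- i) :- con (+ 1)) :* b′
              :+ (con (+ 2) :* (con (+ 1) :+ i) :+ con (+ 1)) :* b :+ a
          := (con (+ 2) :* (con (+ 1) :+ (con (+ 1) :+ (i :+ j)) :- j) :- con (+ 1)) :* b
              :+ (con (+ 2) :* (con (+ 1) :+ j) :+ con (+ 1)) :* b′ :+ a)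
          refl (fromℕ i) (fromℕ j) (β n j) (β n (suc j)) (α n (suc j)))
        (+-congʳ (+-congʳ (*-congʳ (+-congʳ (*-congˡ (+-congʳ (+-congˡ (sym (fromℕ-[1+i+j] i j))))))))))

  -- Reversal with respect to `n` fixes the part `a` and turns `x b` into `b`, hence sends
  -- `M̃ = a + x b` to `M = a + b`.
  reflect : ∀ n i j → i ℕ.+ j ≡ n → q n i ≈ p n j
  reflect n i zero i+0≡n = trans (q≈α+β n i) (trans (+-cong (α-sym n i 0 i+0≡n)
      (β-beyond n i (ℕ.≤-reflexive (≡.trans (≡.sym i+0≡n) (ℕ.+-identityʳ i)))))
    (trans (+-identityʳ _) (sym (p-zero≈α n))))
  reflect n i (suc j) i+1+j≡n = trans (q≈α+β n i) (trans (+-cong (α-sym n i (suc j) i+1+j≡n)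
    (β-sym n i j (≡.trans (≡.sym (ℕ.+-suc i j)) i+1+j≡n))) (sym (p-suc≈α+β n j)))

  p-beyond : ∀ n k → n ℕ.< k → p n k ≈ 0#
  p-beyond n (suc k) (s≤s n≤k) = trans (p-suc≈α+β n k)
    (trans (+-cong (α-beyond n (suc k) (s≤s n≤k)) (β-beyond n k n≤k)) (+-identityʳ 0#))

  q-beyond : ∀ n k → n ℕ.< k → q n k ≈ 0#
  q-beyond n k n<k = trans (q≈α+β n k)
    (trans (+-cong (α-beyond n k n<k) (β-beyond n k (ℕ.<⇒≤ n<k))) (+-identityʳ 0#))

  p-top : ∀ n → p n n ≈ 1#
  p-top n = trans (sym (reflect n 0 n ≡.refl)) (q-zero n)

  0≤q-zero : ∀ n → 0# ≤ q n 0
  0≤q-zero n = inj₁ (<-respʳ-≈ (sym (q-zero n)) 0<1)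

  0≤p-zero : ∀ n → 0# ≤ p n 0
  0≤p-zero zero    = inj₁ 0<1
  0≤p-zero (suc n) = inj₂ (sym (p-zero n))

  -- Alternatingly increasing coefficients.

  0≤fromℕ-fromℕ : ∀ {j n} → j ℕ.≤ n → 0# ≤ fromℕ 2 * (fromℕ n - fromℕ j)
  0≤fromℕ-fromℕ j≤n = 0≤*0≤ (0≤fromℕ 2) (≤⇒0≤- (fromℕ-mono-≤ j≤n))

  0≤positive-combination : ∀ {a b x y z} → 0# ≤ a → 0# ≤ b → 0# ≤ x → 0# ≤ y → 0# ≤ z → 0# ≤ a * x + b * y + z
  0≤positive-combination 0≤a 0≤b 0≤x 0≤y 0≤z = 0≤+0≤ (0≤+0≤ (0≤*0≤ 0≤a 0≤x) (0≤*0≤ 0≤b 0≤y)) 0≤z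

  -- Regrouped into consecutive differences of the chain `p₀ ≤ q₀ ≤ p₁ ≤ q₁ ≤ ⋯`, with factors that
  -- are nonnegative for `j ≤ n`. `p-q-suc` does the same for the other kind of step.
  q-p-suc : ∀ n j → q (suc n) (suc j) - p (suc n) (suc j) ≈
    (fromℕ 2 * (fromℕ n - fromℕ j) + 1#) * (q n j - p n j)
      + (fromℕ 2 * fromℕ (suc j) + 1#) * (q n (suc j) - p n (suc j)) + (p n (suc j) - q n j)
  q-p-suc n j = trans (+-cong (q-suc n j) (-‿cong (p-suc n j)))
    (solve 6 (λ n k q q′ p p′ →
        q′ :+ (con (+ 2) :* n :* q :+ con (+ 2) :* ((con (+ 1) :+ k) :* q′ :- k :* q))
          :- ((con (+ 2) :* n :+ con (+ 1)) :* p :+ con (+ 2) :* ((con (+ 1) :+ k) :* p′ :- k :* p))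
      := (con (+ 2) :* (n :- k) :+ con (+ 1)) :* (q :- p)
          :+ (con (+ 2) :* (con (+ 1) :+ k) :+ con (+ 1)) :* (q′ :- p′) :+ (p′ :- q))
      refl (fromℕ n) (fromℕ j) (q n j) (q n (suc j)) (p n j) (p n (suc j)))

  p-q-suc : ∀ n j → p (suc n) (suc (suc j)) - q (suc n) (suc j) ≈
    fromℕ 2 * fromℕ (suc (suc j)) * (p n (suc (suc j)) - q n (suc j))
      + fromℕ 2 * (fromℕ n - fromℕ j) * (p n (suc j) - q n j) + (q n (suc j) - p n (suc j))
  p-q-suc n j = trans (+-cong (p-suc n (suc j)) (-‿cong (q-suc n j)))
    (solve 6 (λ n k q q′ p′ p″ →
        (con (+ 2) :* n :+ con (+ 1)) :* p′ :+ con (+ 2) :* ((con (+ 1) :+ (con (+ 1) :+ k)) :* p″ :- (con (+ 1) :+ k) :* p′)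
          :- (q′ :+ (con (+ 2) :* n :* q :+ con (+ 2) :* ((con (+ 1) :+ k) :* q′ :- k :* q)))
      := con (+ 2) :* (con (+ 1) :+ (con (+ 1) :+ k)) :* (p″ :- q′)
          :+ con (+ 2) :* (n :- k) :* (p′ :- q) :+ (q′ :- p′))
      refl (fromℕ n) (fromℕ j) (q n j) (q n (suc j)) (p n (suc j)) (p n (suc (suc j))))

  -- At the middle index the first two differences are opposite by reflect and
  -- carry equal coefficients, so they cancel.
  mutual
    p≤q : ∀ n k → k ℕ.+ k ℕ.≤ n → p n k ≤ q n k
    p≤q zero    zero    _ = inj₂ refl
    p≤q (suc n) zero    _ = ≤-respˡ-≈ (sym (p-zero n)) (0≤q-zero (suc n))
    p≤q (suc n) (suc j) (s≤s j+1+j≤n) = 0≤-⇒≤ (≤-respʳ-≈ (sym (q-p-suc n j)) 0≤difference)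
      where
      1+j+j≤n : suc (j ℕ.+ j) ℕ.≤ n
      1+j+j≤n = ≡.subst (ℕ._≤ n) (ℕ.+-suc j j) j+1+j≤n

      j≤n : j ℕ.≤ n
      j≤n = ℕ.≤-trans (ℕ.m≤m+n j (suc j)) j+1+j≤n

      p≤q-j : 0# ≤ q n j - p n j
      p≤q-j = ≤⇒0≤- (p≤q n j (ℕ.<⇒≤ 1+j+j≤n))

      q≤p-j : 0# ≤ p n (suc j) - q n j
      q≤p-j = ≤⇒0≤- (q≤p n j 1+j+j≤n)

      0≤difference : 0# ≤ (fromℕ 2 * (fromℕ n - fromℕ j) + 1#) * (q n j - p n j)
        + (fromℕ 2 * fromℕ (suc j) + 1#) * (q n (suc j) - p n (suc j)) + (p n (suc j) - q n j)
      0≤difference with ℕ.m≤n⇒m<n∨m≡n 1+j+j≤n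
      ... | inj₁ 2+j+j≤n = 0≤positive-combination (0≤+0≤ (0≤fromℕ-fromℕ j≤n) (inj₁ 0<1))
        (0≤+0≤ (0≤*0≤ (0≤fromℕ 2) (0≤fromℕ (suc j))) (inj₁ 0<1)) p≤q-j
        (≤⇒0≤- (p≤q n (suc j) (≡.subst (ℕ._≤ n) (≡.cong suc (≡.sym (ℕ.+-suc j j))) 2+j+j≤n))) q≤p-j
      ... | inj₂ ≡.refl = ≤-respʳ-≈ (sym (trans (+-congʳ
        (+-cong (*-congʳ (+-congʳ (*-congˡ (+-congʳ (fromℕ-[1+i+j] j j)))))
          (*-congˡ (+-cong (reflect n (suc j) j ≡.refl) (-‿cong (sym (reflect n j (suc j) (ℕ.+-suc j j))))))))
        (trans (+-congʳ (solve 3 (λ j q p →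
            (con (+ 2) :* (con (+ 1) :+ (j :+ j) :- j) :+ con (+ 1)) :* (q :- p)
              :+ (con (+ 2) :* (con (+ 1) :+ j) :+ con (+ 1)) :* (p :- q) := con (+ 0))
          refl (fromℕ j) (q n j) (p n j))) (+-identityˡ _)))) q≤p-j

    q≤p : ∀ n k → suc (k ℕ.+ k) ℕ.≤ n → q n k ≤ p n (suc k)
    q≤p (suc zero)    zero    _ = ≤-respʳ-≈ (sym (p-top 1)) (inj₂ (q-zero 1))
    -- The first step of the chain is not an instance of `p-q-suc`: the constant term of `M` stays
    -- 1, so the difference is regrouped around `p n 1 - q n 0` directly.
    q≤p (suc n@(suc _)) zero  _ = 0≤-⇒≤ (≤-respʳ-≈
        (sym (trans (+-cong (p-suc n 0) (-‿cong (trans (q-zero (suc n)) (sym (q-zero n)))))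
          (solve 4 (λ n p p′ q → (con (+ 2) :* n :+ con (+ 1)) :* p
                :+ con (+ 2) :* ((con (+ 1) :+ con (+ 0)) :* p′ :- con (+ 0) :* p) :- q
              := (con (+ 2) :* n :+ con (+ 1)) :* p :+ con (+ 2) :* (p′ :- q) :+ q)
            refl (fromℕ n) (p n 0) (p n 1) (q n 0))))
      (0≤positive-combination (0≤+0≤ (0≤*0≤ (0≤fromℕ 2) (0≤fromℕ n)) (inj₁ 0<1)) (0≤fromℕ 2) (0≤p-zero n)
        (≤⇒0≤- (q≤p n 0 (s≤s z≤n))) (0≤q-zero n)))
    q≤p (suc n) (suc j) (s≤s 1+j+1+j≤n) = 0≤-⇒≤ (≤-respʳ-≈ (sym (p-q-suc n j)) 0≤difference)
      where
      2+j+j≤n : suc (suc (j ℕ.+ j)) ℕ.≤ n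
      2+j+j≤n = ≡.subst (ℕ._≤ n) (≡.cong suc (ℕ.+-suc j j)) 1+j+1+j≤n

      j≤n : j ℕ.≤ n
      j≤n = ℕ.≤-trans (ℕ.m≤m+n j j) (ℕ.≤-trans (ℕ.n≤1+n _) (ℕ.<⇒≤ 2+j+j≤n))

      p≤q-j : 0# ≤ q n (suc j) - p n (suc j)
      p≤q-j = ≤⇒0≤- (p≤q n (suc j) 1+j+1+j≤n)

      0≤difference : 0# ≤ fromℕ 2 * fromℕ (suc (suc j)) * (p n (suc (suc j)) - q n (suc j))
        + fromℕ 2 * (fromℕ n - fromℕ j) * (p n (suc j) - q n j) + (q n (suc j) - p n (suc j))
      0≤difference with ℕ.m≤n⇒m<n∨m≡n 1+j+1+j≤n
      ... | inj₁ 2+j+1+j≤n = 0≤positive-combination (0≤*0≤ (0≤fromℕ 2) (0≤fromℕ (suc (suc j)))) (0≤fromℕ-fromℕ j≤n)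
        (≤⇒0≤- (q≤p n (suc j) 2+j+1+j≤n)) (≤⇒0≤- (q≤p n j (ℕ.<⇒≤ 2+j+j≤n))) p≤q-j
      ... | inj₂ ≡.refl = ≤-respʳ-≈ (sym (trans (+-congʳ
        (+-cong (*-congˡ (+-cong (sym (reflect n j (suc (suc j)) (ℕ.+-suc j (suc j))))
            (-‿cong (reflect n (suc j) (suc j) ≡.refl))))
          (*-congʳ (*-congˡ (+-congʳ (fromℕ-[1+i+j] j (suc j)))))))
        (trans (+-congʳ (solve 3 (λ j q p →
            con (+ 2) :* (con (+ 1) :+ (con (+ 1) :+ j)) :* (q :- p)
              :+ con (+ 2) :* (con (+ 1) :+ (j :+ (con (+ 1) :+ j)) :- j) :* (p :- q) := con (+ 0))
          refl (fromℕ j) (q n j) (p n (suc j)))) (+-identityˡ _)))) p≤q-j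

  private
    2*≡+ : ∀ i → 2 ℕ.* i ≡ i ℕ.+ i
    2*≡+ i = ≡.cong (i ℕ.+_) (ℕ.+-identityʳ i)

    2*+1≡+ : ∀ i → 2 ℕ.* i ℕ.+ 1 ≡ suc (i ℕ.+ i)
    2*+1≡+ i = ≡.trans (ℕ.+-comm (2 ℕ.* i) 1) (≡.cong suc (2*≡+ i))

    i≤d : ∀ i {d} → i ℕ.+ i ℕ.≤ d → i ℕ.≤ d
    i≤d i = ℕ.≤-trans (ℕ.m≤m+n i i)

  M̃-hasDegree : ∀ n → HasDegree (M̃ n) n
  M̃-hasDegree n = 0<⇒≉0 (<-respʳ-≈ (sym (p-top n)) 0<1) , p-beyond n

  M̃-alternatinglyIncreasing : ∀ n → AlternatinglyIncreasing (M̃ n)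
  M̃-alternatinglyIncreasing n = n , M̃-hasDegree n , 0≤p-zero n
    , (λ i 2i≤n → let i+i≤n = ≡.subst (ℕ._≤ n) (2*≡+ i) 2i≤n in
        ≤-respʳ-≈ (reflect n i (n ∸ i) (ℕ.m+[n∸m]≡n (i≤d i i+i≤n))) (p≤q n i i+i≤n))
    , (λ i 2i+1≤n → let 1+i+i≤n = ≡.subst (ℕ._≤ n) (2*+1≡+ i) 2i+1≤n in
        ≤-respˡ-≈ (reflect n i (n ∸ i) (ℕ.m+[n∸m]≡n (i≤d i (ℕ.<⇒≤ 1+i+i≤n)))) (q≤p n i 1+i+i≤n))

  M-degree : ∀ m → DegreeAtMost m (M (suc m))
  M-degree m k m<k with ℕ.m≤n⇒m<n∨m≡n m<k
  ... | inj₁ m+1<k  = q-beyond (suc m) k m+1<k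
  ... | inj₂ ≡.refl = trans (reflect (suc m) (suc m) 0 (ℕ.+-identityʳ (suc m))) (p-zero m)

  -- For positive order the degree is one less than the order, since the top coefficient mirrors the
  -- zero constant term of `M̃`. The chain used for `M̃` is therefore read from its second entry
  -- `q₀` on, with `p` rewritten as mirrored `q`.
  M-alternatinglyIncreasing : ∀ n → AlternatinglyIncreasing (M n)
  M-alternatinglyIncreasing zero = 0
    , ((λ 1≈0 → 0<⇒≉0 0<1 1≈0) , (λ { (suc k) _ → refl }))
    , inj₁ 0<1
    , (λ { zero _ → inj₂ refl })
    , (λ i 2i+1≤0 → contradiction (≡.subst (ℕ._≤ 0) (2*+1≡+ i) 2i+1≤0) λ ())
  M-alternatinglyIncreasing (suc m) = m
    , ( 0<⇒≉0 (<-≤-trans 0<1 (≤-respʳ-≈ (sym (reflect (suc m) m 1 (ℕ.+-comm m 1)))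
          (≤-respˡ-≈ (q-zero (suc m)) (q≤p (suc m) 0 (s≤s z≤n)))))
      , M-degree m)
    , 0≤q-zero (suc m)
    , (λ i 2i≤m → let i+i≤m = ≡.subst (ℕ._≤ m) (2*≡+ i) 2i≤m in
        ≤-respʳ-≈ (sym (reflected i (i≤d i i+i≤m))) (q≤p (suc m) i (s≤s i+i≤m)))
    , (λ i 2i+1≤m → let 1+i+i≤m = ≡.subst (ℕ._≤ m) (2*+1≡+ i) 2i+1≤m in
        ≤-respˡ-≈ (sym (reflected i (i≤d i (ℕ.<⇒≤ 1+i+i≤m))))
          (p≤q (suc m) (suc i) (s≤s (≡.subst (ℕ._≤ m) (≡.sym (ℕ.+-suc i i)) 1+i+i≤m))))
    where
    reflected : ∀ i → i ℕ.≤ m → q (suc m) (m ∸ i) ≈ p (suc m) (suc i)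
    reflected i i≤m = reflect (suc m) (m ∸ i) (suc i)
      (≡.trans (ℕ.+-suc (m ∸ i) i) (≡.cong suc (ℕ.m∸n+n≡m i≤m)))

  -- The symmetric decomposition and `T`.

  coeff-applyUpTo-< : ∀ f {m k} → k ℕ.< m → coeff (applyUpTo f m) k ≈ f k
  coeff-applyUpTo-< f {suc m} {zero}  _         = refl
  coeff-applyUpTo-< f {suc m} {suc k} (s≤s k<m) = coeff-applyUpTo-< (λ i → f (suc i)) k<m

  coeff-applyUpTo-≥ : ∀ f {m k} → m ℕ.≤ k → coeff (applyUpTo f m) k ≈ 0#
  coeff-applyUpTo-≥ f {zero}          _         = refl
  coeff-applyUpTo-≥ f {suc m} {suc k} (s≤s m≤k) = coeff-applyUpTo-≥ (λ i → f (suc i)) m≤k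

  coeff-applyUpTo : ∀ f {m} → (∀ k → m ℕ.≤ k → f k ≈ 0#) → ∀ k → coeff (applyUpTo f m) k ≈ f k
  coeff-applyUpTo f {m} f≈0 k with ℕ.<-≤-connex k m
  ... | inj₁ k<m = coeff-applyUpTo-< f k<m
  ... | inj₂ m≤k = trans (coeff-applyUpTo-≥ f m≤k) (sym (f≈0 k m≤k))

  symmetric : ∀ {n} f → (∀ k → n ℕ.< k → coeff f k ≈ 0#) →
              (∀ i j → i ℕ.+ j ≡ n → coeff f i ≈ coeff f j) → Symmetric n f
  symmetric {n} f f≈0 f-sym = f≈0 , λ k → reflected k (ℕ.<-≤-connex k (suc n))
    where
    reflected : ∀ k → k ℕ.< suc n ⊎ suc n ℕ.≤ k → coeff (ℐ n f) k ≈ coeff f k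
    reflected k (inj₁ k≤n) = trans (coeff-applyUpTo-< (λ i → coeff f (n ∸ i)) k≤n)
      (f-sym (n ∸ k) k (ℕ.m∸n+n≡m (ℕ.s≤s⁻¹ k≤n)))
    reflected k (inj₂ n<k) = trans (coeff-applyUpTo-≥ (λ i → coeff f (n ∸ i)) n<k) (sym (f≈0 k n<k))

  Symmetric-reflect : ∀ {n} f → Symmetric n f → ∀ i j → i ℕ.+ j ≡ n → coeff f i ≈ coeff f j
  Symmetric-reflect {n} f (_ , ℐf≈f) i j i+j≡n = trans (sym (ℐf≈f i))
    (trans (coeff-applyUpTo-< (λ k → coeff f (n ∸ k)) (s≤s (≡.subst (i ℕ.≤_) i+j≡n (ℕ.m≤m+n i j))))
      (reflexive (≡.cong (coeff f) (≡.trans (≡.cong (_∸ i) (≡.sym i+j≡n)) (ℕ.m+n∸m≡n i j)))))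

  A B : ℕ → Poly
  A n = applyUpTo (α n) (suc n)
  B n = applyUpTo (β n) n

  coeff-A : ∀ n k → coeff (A n) k ≈ α n k
  coeff-A n = coeff-applyUpTo (α n) (α-beyond n)

  coeff-B : ∀ n k → coeff (B n) k ≈ β n k
  coeff-B n = coeff-applyUpTo (β n) (β-beyond n)

  M≈A+B : ∀ n → M n ≈ₚ A n +ₚ B n
  M≈A+B n k = trans (q≈α+β n k) (sym (trans (coeff-+ (A n) (B n) k) (+-cong (coeff-A n k) (coeff-B n k))))

  M̃≈A+XB : ∀ n → M̃ n ≈ₚ A n +ₚ X *ₚ B n
  M̃≈A+XB n zero    = trans (p-zero≈α n) (sym (trans (coeff-+ (A n) (X *ₚ B n) 0)
    (trans (+-cong (coeff-A n 0) (coeff-X*-zero (B n))) (+-identityʳ _))))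
  M̃≈A+XB n (suc k) = trans (p-suc≈α+β n k) (sym (trans (coeff-+ (A n) (X *ₚ B n) (suc k))
    (+-cong (coeff-A n (suc k)) (trans (coeff-X*-suc (B n) k) (coeff-B n k)))))

  isDecomposition : ∀ n → IsDecomposition n (M̃ n) (A n) (B n)
  isDecomposition n = M̃≈A+XB n
    , symmetric (A n) (λ k n<k → trans (coeff-A n k) (α-beyond n k n<k))
        (λ i j i+j≡n → trans (coeff-A n i) (trans (α-sym n i j i+j≡n) (sym (coeff-A n j))))
    , B-symmetric n
    where
    B-symmetric : ∀ n → SymmetricPred n (B n)
    B-symmetric zero    = λ _ → refl
    B-symmetric (suc m) = symmetric (B (suc m)) (λ k m<k → trans (coeff-B (suc m) k) (β-beyond (suc m) k m<k))
      (λ i j i+j≡m → trans (coeff-B (suc m) i) (trans (β-sym (suc m) i j (≡.cong suc i+j≡m)) (sym (coeff-B (suc m) j))))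

  T : ℕ → Poly
  T n = substSquare (A n) +ₚ X *ₚ substSquare (B n)

  isT : ∀ n → IsT n (T n)
  isT n = eval-injective ((𝟏 +ₚ X) *ₚ T n) (X *ₚ substSquare (M n) +ₚ substSquare (M̃ n)) λ x →
    let a = eval (A n) (x * x) ; b = eval (B n) (x * x) in
    trans (eval-* (𝟏 +ₚ X) (T n) x) (trans (*-cong
      (trans (eval-+ 𝟏 X x) (+-cong (eval-𝟏 x) (eval-X x)))
      (trans (eval-+ (substSquare (A n)) (X *ₚ substSquare (B n)) x) (+-cong (eval-substSquare (A n) x)
        (trans (eval-X* (substSquare (B n)) x) (*-congˡ (eval-substSquare (B n) x))))))
    (trans (solve 3 (λ x a b → (con (+ 1) :+ x) :* (a :+ x :* b) := x :* (a :+ b) :+ (a :+ x :* x :* b)) refl x a b)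
      (sym (trans (eval-+ (X *ₚ substSquare (M n)) (substSquare (M̃ n)) x) (+-cong
        (trans (eval-X* (substSquare (M n)) x) (*-congˡ (trans (eval-substSquare (M n) x)
          (trans (eval-cong (M n) (A n +ₚ B n) (M≈A+B n)) (eval-+ (A n) (B n) (x * x))))))
        (trans (eval-substSquare (M̃ n) x) (trans (eval-cong (M̃ n) (A n +ₚ X *ₚ B n) (M̃≈A+XB n))
          (trans (eval-+ (A n) (X *ₚ B n) (x * x)) (+-congˡ (eval-X* (B n) (x * x)))))))))))

  -- Applying ℐ n to M̃ n = a + X b gives M n = a + b.
  M≈a+b : ∀ n a b → IsDecomposition n (M̃ n) a b → M n ≈ₚ a +ₚ b
  M≈a+b n a b (M̃≈a+Xb , (a≈0 , ℐa≈a) , b-sym) k =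
    trans (sum k (ℕ.<-≤-connex n k)) (sym (coeff-+ a b k))
    where
    p≈ : ∀ k → p n k ≈ coeff a k + coeff (X *ₚ b) k
    p≈ k = trans (M̃≈a+Xb k) (coeff-+ a (X *ₚ b) k)

    b-beyond : ∀ n → SymmetricPred n b → ∀ k → n ℕ.≤ k → coeff b k ≈ 0#
    b-beyond zero    b≈0       k _   = b≈0 k
    b-beyond (suc m) (b≈0 , _) k m<k = b≈0 k m<k

    reflect-b : ∀ n → SymmetricPred n b → ∀ i j → suc (i ℕ.+ j) ≡ n → coeff b i ≈ coeff b j
    reflect-b (suc m) sym-b i j i+j≡m = Symmetric-reflect b sym-b i j (ℕ.suc-injective i+j≡m)

    sum′ : ∀ k j → k ℕ.+ j ≡ n → q n k ≈ coeff a k + coeff b k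
    sum′ k zero    k+0≡n = trans (reflect n k 0 k+0≡n) (trans (p≈ 0)
      (+-cong (Symmetric-reflect a (a≈0 , ℐa≈a) 0 k (≡.trans (≡.sym (ℕ.+-identityʳ k)) k+0≡n))
        (trans (coeff-X*-zero b) (sym (b-beyond n b-sym k
          (ℕ.≤-reflexive (≡.trans (≡.sym k+0≡n) (ℕ.+-identityʳ k))))))))
    sum′ k (suc j) k+1+j≡n = trans (reflect n k (suc j) k+1+j≡n) (trans (p≈ (suc j))
      (+-cong (sym (Symmetric-reflect a (a≈0 , ℐa≈a) k (suc j) k+1+j≡n))
        (trans (coeff-X*-suc b j) (sym (reflect-b n b-sym k j (≡.trans (≡.sym (ℕ.+-suc k j)) k+1+j≡n))))))

    sum : ∀ k → n ℕ.< k ⊎ k ℕ.≤ n → q n k ≈ coeff a k + coeff b k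
    sum k (inj₁ n<k) = trans (q-beyond n k n<k)
      (sym (trans (+-cong (a≈0 k n<k) (b-beyond n b-sym k (ℕ.<⇒≤ n<k))) (+-identityʳ 0#)))
    sum k (inj₂ k≤n) = sum′ k (n ∸ k) (ℕ.m+[n∸m]≡n k≤n)

  module _ (m : ℕ) (a b : Poly) (dec : IsDecomposition (suc m) (M̃ (suc m)) a b) where

    private
      M̃≈a+Xb : M̃ (suc m) ≈ₚ a +ₚ X *ₚ b
      M̃≈a+Xb = proj₁ dec

      a-sym : Symmetric (suc m) a
      a-sym = proj₁ (proj₂ dec)

    a-zero : coeff a 0 ≈ 0#
    a-zero = trans (sym (trans (coeff-+ a (X *ₚ b) 0) (trans (+-congˡ (coeff-X*-zero b)) (+-identityʳ _))))
      (trans (sym (M̃≈a+Xb 0)) (p-zero m))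

    a-top : coeff a (suc m) ≈ 0#
    a-top = trans (Symmetric-reflect a a-sym (suc m) 0 (ℕ.+-identityʳ (suc m))) a-zero

    a-degree : DegreeAtMost m a
    a-degree k m<k with ℕ.m≤n⇒m<n∨m≡n m<k
    ... | inj₁ 1+m<k  = proj₁ a-sym k 1+m<k
    ... | inj₂ ≡.refl = a-top

    b-degree : DegreeAtMost m b
    b-degree = proj₁ (proj₂ (proj₂ dec))

    b-leading : coeff b m ≈ 1#
    b-leading = trans (sym (trans (coeff-+ a (X *ₚ b) (suc m))
      (trans (+-cong a-top (coeff-X*-suc b m)) (+-identityˡ _)))) (trans (sym (M̃≈a+Xb (suc m))) (p-top (suc m)))

    -- Since `a = M - b` and `b` is monic, the coefficient is `p (suc m) 1 - 1 = 1 + (2m + 1) p m 0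
    -- + 2 (p m 1 - 1)`. The last term is nonnegative by the first step `1 = q m 0 ≤ p m 1` of the
    -- alternating chain.
    a-leading : 1 ℕ.≤ m → 0# < coeff a m
    a-leading 1≤m = <-respʳ-≈ (sym a≈p-1) (0<+0≤ 0<1 (0≤+0≤
        (0≤*0≤ (0≤+0≤ (0≤*0≤ (0≤fromℕ 2) (0≤fromℕ m)) (inj₁ 0<1)) (0≤p-zero m))
        (0≤*0≤ (0≤fromℕ 2) (≤⇒0≤- (≤-respˡ-≈ (q-zero m) (q≤p m 0 1≤m))))))
      where
      a≈p-1 : coeff a m ≈ 1# + ((fromℕ 2 * fromℕ m + 1#) * p m 0 + fromℕ 2 * (p m 1 - 1#))
      a≈p-1 = trans (solve 2 (λ a b → a := a :+ b :- b) refl (coeff a m) (coeff b m))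
        (trans (+-cong (trans (sym (coeff-+ a b m)) (trans (sym (M≈a+b (suc m) a b dec m))
            (trans (reflect (suc m) m 1 (ℕ.+-comm m 1)) (p-suc m 0)))) (-‿cong b-leading))
          (solve 3 (λ m p p′ → (con (+ 2) :* m :+ con (+ 1)) :* p
                :+ con (+ 2) :* ((con (+ 1) :+ con (+ 0)) :* p′ :- con (+ 0) :* p) :- con (+ 1)
              := con (+ 1) :+ ((con (+ 2) :* m :+ con (+ 1)) :* p :+ con (+ 2) :* (p′ :- con (+ 1))))
            refl (fromℕ m) (p m 0) (p m 1)))

  -- The zeros of `M̃` and the signs of `M` there.

  ∏ₚ : ∀ {n} → Vec Carrier n → Poly
  ∏ₚ v = ∏[X- lookup v ]

  lagrangeₚ : ∀ {n} → Vec Carrier n → Vec Carrier n → Poly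
  lagrangeₚ []      []      = 𝟎
  lagrangeₚ (ρ ∷ v) (c ∷ w) = c ∙ₚ ∏ₚ v +ₚ (- ρ ∷ 1# ∷ []) *ₚ lagrangeₚ v w

  eval-X- : ∀ ρ x → eval (- ρ ∷ 1# ∷ []) x ≈ x - ρ
  eval-X- ρ x = trans (eval-linear (- ρ) 1# x) (solve 2 (λ r x → :- r :+ con (+ 1) :* x := x :- r) refl ρ x)

  deriv-X-* : ∀ ρ f x → deriv ((- ρ ∷ 1# ∷ []) *ₚ f) x ≈ eval f x + (x - ρ) * deriv f x
  deriv-X-* ρ f x = trans (deriv-* (- ρ ∷ 1# ∷ []) f x) (+-cong
    (trans (*-congʳ (solve 1 (λ x → con (+ 1) :+ x :* con (+ 0) :+ x :* (con (+ 0) :+ x :* con (+ 0)) := con (+ 1)) refl x))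
      (*-identityˡ _))
    (*-congʳ (eval-X- ρ x)))

  eval-∏ₚ : ∀ {n} (v : Vec Carrier n) x → eval (∏ₚ v) x ≈ ∏ v x
  eval-∏ₚ []      x = eval-𝟏 x
  eval-∏ₚ (ρ ∷ v) x = trans (eval-* (- ρ ∷ 1# ∷ []) (∏ₚ v) x) (*-cong (eval-X- ρ x) (eval-∏ₚ v x))

  deriv-∏ₚ : ∀ {n} (v : Vec Carrier n) x → deriv (∏ₚ v) x ≈ ∏′ v x
  deriv-∏ₚ []      x = trans (+-identityˡ _) (zeroʳ x)
  deriv-∏ₚ (ρ ∷ v) x = trans (deriv-X-* ρ (∏ₚ v) x) (+-cong (eval-∏ₚ v x) (*-congˡ (deriv-∏ₚ v x)))

  eval-lagrangeₚ : ∀ {n} (v w : Vec Carrier n) x → eval (lagrangeₚ v w) x ≈ lagrange v w x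
  eval-lagrangeₚ []      []      x = refl
  eval-lagrangeₚ (ρ ∷ v) (c ∷ w) x = trans (eval-+ (c ∙ₚ ∏ₚ v) _ x) (+-cong
    (trans (eval-∙ c (∏ₚ v) x) (*-congˡ (eval-∏ₚ v x)))
    (trans (eval-* (- ρ ∷ 1# ∷ []) (lagrangeₚ v w) x) (*-cong (eval-X- ρ x) (eval-lagrangeₚ v w x))))

  deriv-lagrangeₚ : ∀ {n} (v w : Vec Carrier n) x → deriv (lagrangeₚ v w) x ≈ lagrange′ v w x
  deriv-lagrangeₚ []      []      x = refl
  deriv-lagrangeₚ (ρ ∷ v) (c ∷ w) x = trans (deriv-+ (c ∙ₚ ∏ₚ v) _ x) (+-cong
    (trans (deriv-∙ c (∏ₚ v) x) (*-congˡ (deriv-∏ₚ v x)))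
    (trans (deriv-X-* ρ (lagrangeₚ v w) x) (+-cong (eval-lagrangeₚ v w x) (*-congˡ (deriv-lagrangeₚ v w x)))))

  eval-at-0 : ∀ f → eval f 0# ≈ coeff f 0
  eval-at-0 []      = refl
  eval-at-0 (a ∷ f) = trans (+-congˡ (zeroˡ _)) (+-identityʳ a)

  -- The induction invariant. The largest zero of `M̃ (suc m)` is always `0#` and is kept apart from
  -- the others; `M̃ (suc m)` is monic, so its factorisation carries no constant.
  record IsNodes (m : ℕ) (ρs : Vec Carrier m) : Set where
    field
      descending  : Descending (0# ∷ ρs)
      factored    : ∀ x → eval (M̃ (suc m)) x ≈ ∏ (0# ∷ ρs) x
      alternating : Alternating (eval (M (suc m))) (0# ∷ ρs)

    nonpositive : All (_≤ 0#) (0# ∷ ρs)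
    nonpositive with descending
    ... | ρs<0 ∷ _ = inj₂ refl ∷ All.map inj₁ ρs<0

    M̃≈∏ₚ : M̃ (suc m) ≈ₚ ∏ₚ (0# ∷ ρs)
    M̃≈∏ₚ = eval-injective (M̃ (suc m)) (∏ₚ (0# ∷ ρs)) λ x → trans (factored x) (sym (eval-∏ₚ (0# ∷ ρs) x))

    weights : ∃[ w ] All (0# <_) w × M (suc m) ≈ₚ lagrangeₚ (0# ∷ ρs) w
    weights with interpolate (eval-PolyFun (M (suc m)) (M-degree m)) descending alternating
    ... | w , 0<w , M≈ = w , 0<w , eval-injective (M (suc m)) (lagrangeₚ (0# ∷ ρs) w)
        λ x → trans (M≈ x) (sym (eval-lagrangeₚ (0# ∷ ρs) w x))

  0<1-x : ∀ {x} → x ≤ 0# → 0# < 1# - x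
  0<1-x x≤0 = 0<+0≤ 0<1 (≤-respʳ-≈ (+-identityˡ _) (≤⇒0≤- x≤0))

  -0≈0 : - 0# ≈ 0#
  -0≈0 = solve 0 (:- con (+ 0) := con (+ 0)) refl

  Alternating-nonzero : ∀ {n f} {v : Vec Carrier n} → Alternating f v → All (λ x → ¬ (f x ≈ 0#)) v
  Alternating-nonzero {v = []}    tt        = []
  Alternating-nonzero {v = _ ∷ _} (0<f , a) =
    0<⇒≉0 0<f ∷ All.map (λ -f≉0 f≈0 → -f≉0 (trans (-‿cong f≈0) -0≈0)) (Alternating-nonzero a)

  eval-M-at-0 : ∀ n → 0# < eval (M n) 0#
  eval-M-at-0 n = <-respʳ-≈ (sym (trans (eval-at-0 (M n)) (q-zero n))) 0<1

  -- At a zero τ of the new M̃ the product ∏ v τ * M₊ τ is a positive multiple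
  -- of the Wronskian, so M₊ alternates along these zeros as ∏ v does.
  next-zeros : ∀ {n} {v w : Vec Carrier (suc n)} c {Q M₊ : Carrier → Carrier} →
    Descending v → All (_≤ 0#) v → All (0# <_) w → PolyFun (suc n) 1# Q →
    (∀ x → Q x ≈ (fromℕ 2 * c + 1#) * ∏ v x + fromℕ 2 * (1# - x) * ∏′ v x) →
    (∀ x → M₊ x ≈ (fromℕ 2 * c * x + 1#) * lagrange v w x + fromℕ 2 * x * (1# - x) * lagrange′ v w x) →
    ∃[ τs ] v ⋗ τs × FactorsOver {suc n} 1# Q τs × Alternating (λ x → - M₊ x) τs
  next-zeros {v = v@(_ ∷ _)} {w} c {Q} {M₊} desc v≤0 0<w Q-PolyFun Q≈∏ M₊≈
    with roots-below 0<1 Q-PolyFun desc Q-alternating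
    where
    Q-alternating : Alternating Q v
    Q-alternating = Alternating-⇛ (All.map (λ { {x} (∏≈0 , x≤0) →
        positive-multiple-⇛ (*-pos (0<fromℕ-suc 1) (0<1-x x≤0))
          (trans (Q≈∏ x) (trans (+-congʳ (trans (*-congˡ ∏≈0) (zeroʳ _))) (+-identityˡ _))) })
      (All.zip (∏-zeros v , v≤0))) (∏′-alternating desc)
  ... | τs , v⋗τs@(τs<ρ ∷ _) , Q≈ = τs , v⋗τs , Q≈ , Alternating-⇛
      (All.map sign (All.zip (τs<0 , All.zip (Alternating-nonzero -∏-alternating , ∏-zeros τs)))) -∏-alternating
    where
    τs<0 : All (_< 0#) τs
    τs<0 = All.map (λ τ<ρ → <-≤-trans τ<ρ (All.head v≤0)) τs<ρ

    -∏-alternating : Alternating (λ x → - ∏ v x) τs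
    -∏-alternating = proj₂ (⋗-alternating v⋗τs)

    ∏*M₊ : ∀ x → ∏ v x * M₊ x ≈ (1# - x) * wronskian v w x + x * lagrange v w x * Q x
    ∏*M₊ x = trans (*-congˡ (M₊≈ x)) (trans
      (solve 6 (λ c x P P′ g g′ →
          P :* ((con (+ 2) :* c :* x :+ con (+ 1)) :* g :+ con (+ 2) :* x :* (con (+ 1) :- x) :* g′)
        := (con (+ 1) :- x) :* (g :* P :+ con (+ 2) :* x :* (g′ :* P :- P′ :* g))
          :+ x :* g :* ((con (+ 2) :* c :+ con (+ 1)) :* P :+ con (+ 2) :* (con (+ 1) :- x) :* P′))
        refl c x (∏ v x) (∏′ v x) (lagrange v w x) (lagrange′ v w x))
      (+-congˡ (*-congˡ (sym (Q≈∏ x)))))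

    sign : ∀ {τ} → τ < 0# × ¬ (- ∏ v τ ≈ 0#) × ∏ τs τ ≈ 0# → - ∏ v τ ⇛ - M₊ τ
    sign {τ} (τ<0 , -∏≉0 , ∏≈0) = ⇛-neg (positive-product-⇛ (<-respʳ-≈ (sym (trans (∏*M₊ τ)
      (trans (+-congˡ (trans (*-congˡ (trans (Q≈ τ) (trans (*-congˡ ∏≈0) (zeroʳ _)))) (zeroʳ _))) (+-identityʳ _))))
      (*-pos (0<1-x (inj₁ τ<0)) (wronskian-positive {v = v} {w} τ<0 v≤0 0<w
        λ ∏≈0 → -∏≉0 (trans (-‿cong ∏≈0) -0≈0)))))

  nodes-step : ∀ {m ρs} → IsNodes m ρs → ∃[ τs ] IsNodes (suc m) τs
  nodes-step {m} {ρs} nodes = result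
      (next-zeros (fromℕ n) (IsNodes.descending nodes) (IsNodes.nonpositive nodes) (proj₁ (proj₂ weights))
        Q-PolyFun eval-Q eval-M)
    where
    open IsNodes nodes using (weights)

    n : ℕ
    n = suc m

    v : Vec Carrier n
    v = 0# ∷ ρs

    w : Vec Carrier n
    w = proj₁ weights

    M≈ : M n ≈ₚ lagrangeₚ v w
    M≈ = proj₂ (proj₂ weights)

    Q : Poly
    Q = step (fromℕ 2 * fromℕ n + 1#) (M̃ n)

    coeff-Q : ∀ k → coeff Q k ≈ p (suc n) (suc k)
    coeff-Q k = trans (sym (coeff-X*-suc Q k)) (sym (M̃-suc n (suc k)))

    Q-PolyFun : PolyFun n 1# (eval Q)
    Q-PolyFun = PolyFun-congˡ (trans (coeff-Q n) (p-top (suc n)))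
      (eval-PolyFun Q λ k n<k → trans (coeff-Q k) (p-beyond (suc n) (suc k) (s≤s n<k)))

    eval-Q : ∀ x → eval Q x ≈ (fromℕ 2 * fromℕ n + 1#) * ∏ v x + fromℕ 2 * (1# - x) * ∏′ v x
    eval-Q x = trans (eval-step (fromℕ 2 * fromℕ n + 1#) (M̃ n) x) (+-cong (*-congˡ (IsNodes.factored nodes x))
      (*-congˡ (trans (deriv-cong (M̃ n) (∏ₚ v) (IsNodes.M̃≈∏ₚ nodes)) (deriv-∏ₚ v x))))

    eval-M : ∀ x → eval (M (suc n)) x ≈
      (fromℕ 2 * fromℕ n * x + 1#) * lagrange v w x + fromℕ 2 * x * (1# - x) * lagrange′ v w x
    eval-M x = trans (eval-M-suc n x) (+-cong
      (*-congˡ (trans (eval-cong (M n) (lagrangeₚ v w) M≈) (eval-lagrangeₚ v w x)))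
      (*-congˡ (trans (deriv-cong (M n) (lagrangeₚ v w) M≈) (deriv-lagrangeₚ v w x))))

    result : ∃[ τs ] v ⋗ τs × FactorsOver {n} 1# (eval Q) τs × Alternating (λ x → - eval (M (suc n)) x) τs →
             ∃[ τs ] IsNodes n τs
    result (τs , v⋗τs@(τs<0 ∷ _) , Q≈ , alt) = τs , record
      -- The factor `x` of the new `M̃` puts `0#` above all `τs`. There the new `M` has the value 1,
      -- which starts the alternation.
      { descending  = τs<0 ∷ proj₂ (⋗-descending v⋗τs)
      ; factored    = λ x → trans (eval-cong (M̃ (suc n)) (X *ₚ Q) (M̃-suc n)) (trans (eval-X* Q x)
          (trans (*-congˡ (Q≈ x)) (solve 2 (λ x y → x :* (con (+ 1) :* y) := (x :- con (+ 0)) :* y) refl x (∏ τs x))))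
      ; alternating = eval-M-at-0 (suc n) , alt
      }

  nodes : ∀ m → ∃[ ρs ] IsNodes m ρs
  nodes zero    = [] , record
    { descending  = [] ∷ []
    ; factored    = λ x → trans (eval-M̃-suc 0 x) (solve 1 (λ x →
        (con (+ 2) :* con (+ 0) :+ con (+ 1)) :* x :* (con (+ 1) :+ x :* con (+ 0))
          :+ con (+ 2) :* x :* (con (+ 1) :- x) :* (con (+ 0) :+ x :* con (+ 0))
        := (x :- con (+ 0)) :* con (+ 1)) refl x)
    ; alternating = eval-M-at-0 1 , tt
    }
  nodes (suc m) = nodes-step (proj₂ (nodes m))

  -- Complex evaluation and Hurwitz stability.

  infix 4 _≈ᶜ_
  _≈ᶜ_ : ℂ → ℂ → Set
  z ≈ᶜ w = re z ≈ re w × im z ≈ im w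

  ℂ-ring : CommutativeRing 0ℓ 0ℓ
  ℂ-ring = record
    { Carrier = ℂ ; _≈_ = _≈ᶜ_ ; _+_ = _+ᶜ_ ; _*_ = _*ᶜ_ ; -_ = λ z → (- re z) +i (- im z)
    ; 0# = 0# +i 0# ; 1# = 1# +i 0#
    ; isCommutativeRing = record
      { isRing = record
        { +-isAbelianGroup = record
          { isGroup = record
            { isMonoid = record
              { isSemigroup = record
                { isMagma = record
                  { isEquivalence = record
                    { refl  = refl , refl
                    ; sym   = λ (r , i) → sym r , sym i
                    ; trans = λ (r , i) (r′ , i′) → trans r r′ , trans i i′
                    }
                  ; ∙-cong = λ (r , i) (r′ , i′) → +-cong r r′ , +-cong i i′
                  }
                ; assoc = λ x y z → +-assoc (re x) (re y) (re z) , +-assoc (im x) (im y) (im z)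
                }
              ; identity = (λ z → +-identityˡ _ , +-identityˡ _) , (λ z → +-identityʳ _ , +-identityʳ _)
              }
            ; inverse = (λ z → -‿inverseˡ _ , -‿inverseˡ _) , (λ z → -‿inverseʳ _ , -‿inverseʳ _)
            ; ⁻¹-cong = λ (r , i) → -‿cong r , -‿cong i
            }
          ; comm = λ z w → +-comm _ _ , +-comm _ _
          }
        ; *-cong = λ (r , i) (r′ , i′) →
            +-cong (*-cong r r′) (-‿cong (*-cong i i′)) , +-cong (*-cong r i′) (*-cong i r′)
        ; *-assoc = λ x y z →
            solve 6 (λ a b c d e f → (a :* c :- b :* d) :* e :- (a :* d :+ b :* c) :* f
                                  := a :* (c :* e :- d :* f) :- b :* (c :* f :+ d :* e))
              refl (re x) (im x) (re y) (im y) (re z) (im z)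
          , solve 6 (λ a b c d e f → (a :* c :- b :* d) :* f :+ (a :* d :+ b :* c) :* e
                                  := a :* (c :* f :+ d :* e) :+ b :* (c :* e :- d :* f))
              refl (re x) (im x) (re y) (im y) (re z) (im z)
        ; *-identity = (λ z →
              solve 2 (λ a b → con (+ 1) :* a :- con (+ 0) :* b := a) refl (re z) (im z)
            , solve 2 (λ a b → con (+ 1) :* b :+ con (+ 0) :* a := b) refl (re z) (im z))
          , (λ z →
              solve 2 (λ a b → a :* con (+ 1) :- b :* con (+ 0) := a) refl (re z) (im z)
            , solve 2 (λ a b → a :* con (+ 0) :+ b :* con (+ 1) := b) refl (re z) (im z))
        ; distrib = (λ x y z →
              solve 6 (λ a b c d e f → a :* (c :+ e) :- b :* (d :+ f) := (a :* c :- b :* d) :+ (a :* e :- b :* f))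
                refl (re x) (im x) (re y) (im y) (re z) (im z)
            , solve 6 (λ a b c d e f → a :* (d :+ f) :+ b :* (c :+ e) := (a :* d :+ b :* c) :+ (a :* f :+ b :* e))
                refl (re x) (im x) (re y) (im y) (re z) (im z))
          , (λ x y z →
              solve 6 (λ a b c d e f → (c :+ e) :* a :- (d :+ f) :* b := (c :* a :- d :* b) :+ (e :* a :- f :* b))
                refl (re x) (im x) (re y) (im y) (re z) (im z)
            , solve 6 (λ a b c d e f → (c :+ e) :* b :+ (d :+ f) :* a := (c :* b :+ d :* a) :+ (e :* b :+ f :* a))
                refl (re x) (im x) (re y) (im y) (re z) (im z))
        }
      ; *-comm = λ z w →
            solve 4 (λ a b c d → a :* c :- b :* d := c :* a :- d :* b) refl (re z) (im z) (re w) (im w)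
          , solve 4 (λ a b c d → a :* d :+ b :* c := c :* b :+ d :* a) refl (re z) (im z) (re w) (im w)
      }
    }
    where
    open CommutativeRing commutativeRing using (+-assoc; +-comm; -‿inverseˡ)

  module ℂ-ring = CommutativeRing ℂ-ring

  ℂ-algebra : RealAlgebra
  ℂ-algebra = record
    { ring = ℂ-ring ; φ = λ a → a +i 0# ; φ-cong = λ a≈b → a≈b , refl
    ; φ-0 = refl , refl ; φ-1 = refl , refl
    ; φ-+ = λ _ _ → refl , sym (+-identityˡ 0#)
    ; φ-* = λ a b → solve 2 (λ a b → a :* b := a :* b :- con (+ 0) :* con (+ 0)) refl a b
                  , solve 2 (λ a b → con (+ 0) := a :* con (+ 0) :+ con (+ 0) :* b) refl a b
    }

  -- Evalᶜ.eval and evalᶜ are definitionally equal.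
  module Evalᶜ = Eval ℂ-algebra

  ∣_∣² : ℂ → Carrier
  ∣ z ∣² = re z * re z + im z * im z

  -- The real part of z times the conjugate of w.
  ⟨_,_⟩ : ℂ → ℂ → Carrier
  ⟨ z , w ⟩ = re z * re w + im z * im w

  ∣∣²-cong : ∀ {z w} → z ≈ᶜ w → ∣ z ∣² ≈ ∣ w ∣²
  ∣∣²-cong (r , i) = +-cong (*-cong r r) (*-cong i i)

  ⟨⟩-cong : ∀ {z z′ w w′} → z ≈ᶜ z′ → w ≈ᶜ w′ → ⟨ z , w ⟩ ≈ ⟨ z′ , w′ ⟩
  ⟨⟩-cong (r , i) (r′ , i′) = +-cong (*-cong r r′) (*-cong i i′)

  ∣∣²-* : ∀ z w → ∣ z *ᶜ w ∣² ≈ ∣ z ∣² * ∣ w ∣²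
  ∣∣²-* z w = solve 4 (λ a b c d →
      (a :* c :- b :* d) :* (a :* c :- b :* d) :+ (a :* d :+ b :* c) :* (a :* d :+ b :* c)
    := (a :* a :+ b :* b) :* (c :* c :+ d :* d)) refl (re z) (im z) (re w) (im w)

  0≤∣∣² : ∀ z → 0# ≤ ∣ z ∣²
  0≤∣∣² z = 0≤+0≤ (0≤x² (re z)) (0≤x² (im z))

  0<⟨⟩⇒0<∣∣² : ∀ z w → 0# < ⟨ z , w ⟩ → 0# < ∣ w ∣²
  0<⟨⟩⇒0<∣∣² z w 0<zw with compare (re w) 0#
  ... | tri< _ r≉0 _ = 0<+0≤ (x≉0⇒0<x² r≉0) (0≤x² (im w))
  ... | tri> _ r≉0 _ = 0<+0≤ (x≉0⇒0<x² r≉0) (0≤x² (im w))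
  ... | tri≈ _ r≈0 _ = <-respʳ-≈ (solve 2 (λ x y → x :+ y := y :+ x) refl _ _)
        (0<+0≤ (x≉0⇒0<x² i≉0) (0≤x² (re w)))
    where
    i≉0 : ¬ (im w ≈ 0#)
    i≉0 i≈0 = 0<⇒≉0 0<zw (trans (+-cong (*-congˡ r≈0) (*-congˡ i≈0))
      (solve 2 (λ a b → a :* con (+ 0) :+ b :* con (+ 0) := con (+ 0)) refl (re z) (im z)))

  infix 6 _-ᶜ_
  _-ᶜ_ : ℂ → Carrier → ℂ
  z -ᶜ ρ = (re z - ρ) +i im z

  module _ (z : ℂ) (0<re : 0# < re z) where

    z² : ℂ
    z² = z *ᶜ z

    -- For `z = s + i t` this is `s (s² + t² - ρ)`. It has the sign of the real part of
    -- `z / (z² - ρ)`, and its positivity also shows that `z² - ρ` is nonzero.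
    0<⟨z,z²-ρ⟩ : ∀ {ρ} → ρ ≤ 0# → 0# < ⟨ z , z² -ᶜ ρ ⟩
    0<⟨z,z²-ρ⟩ {ρ} ρ≤0 = <-respʳ-≈
      (solve 3 (λ s t r → s :* (s :* s :+ (t :* t :+ (con (+ 0) :- r)))
          := s :* (s :* s :- t :* t :- r) :+ t :* (s :* t :+ t :* s)) refl (re z) (im z) ρ)
      (*-pos 0<re (0<+0≤ (*-pos 0<re 0<re) (0≤+0≤ (0≤x² (im z)) (≤⇒0≤- ρ≤0))))

    eval-X-ρ* : ∀ ρ f → evalᶜ ((- ρ ∷ 1# ∷ []) *ₚ f) z² ≈ᶜ (z² -ᶜ ρ) *ᶜ evalᶜ f z²
    eval-X-ρ* ρ f = ℂ-ring.trans (Evalᶜ.eval-* (- ρ ∷ 1# ∷ []) f z²) (ℂ-ring.*-congʳ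
      (ℂ-ring.trans (Evalᶜ.eval-linear (- ρ) 1# z²)
        ( solve 3 (λ r a b → :- r :+ (con (+ 1) :* a :- con (+ 0) :* b) := a :- r) refl ρ (re z²) (im z²)
        , solve 2 (λ a b → con (+ 0) :+ (con (+ 1) :* b :+ con (+ 0) :* a) := b) refl (re z²) (im z²))))

    0<∣∏∣² : ∀ {n} {v : Vec Carrier n} → All (_≤ 0#) v → 0# < ∣ evalᶜ (∏ₚ v) z² ∣²
    0<∣∏∣² []                    = <-respʳ-≈ (trans
      (solve 0 (con (+ 1) := con (+ 1) :* con (+ 1) :+ con (+ 0) :* con (+ 0)) refl)
      (∣∣²-cong (ℂ-ring.sym (Evalᶜ.eval-𝟏 z²)))) 0<1
    0<∣∏∣² {v = ρ ∷ v} (ρ≤0 ∷ v≤0) = <-respʳ-≈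
      (trans (sym (∣∣²-* (z² -ᶜ ρ) (evalᶜ (∏ₚ v) z²))) (∣∣²-cong (ℂ-ring.sym (eval-X-ρ* ρ (∏ₚ v)))))
      (*-pos (0<⟨⟩⇒0<∣∣² z (z² -ᶜ ρ) (0<⟨z,z²-ρ⟩ ρ≤0)) (0<∣∏∣² v≤0))

    -- This is the statement that z · lagrange / ∏, taken at z², has nonnegative
    -- real part, because z / (z² - ρ) has.
    0≤⟨z*lagrange,∏⟩ : ∀ {n} {v w : Vec Carrier n} → All (_≤ 0#) v → All (0# <_) w →
                       0# ≤ ⟨ z *ᶜ evalᶜ (lagrangeₚ v w) z² , evalᶜ (∏ₚ v) z² ⟩
    0≤⟨z*lagrange,∏⟩ {v = []}    {[]}    []          []          = inj₂ (solve 4 (λ s t a b →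
        con (+ 0) := (s :* con (+ 0) :- t :* con (+ 0)) :* a :+ (s :* con (+ 0) :+ t :* con (+ 0)) :* b)
      refl (re z) (im z) _ _)
    0≤⟨z*lagrange,∏⟩ {v = ρ ∷ v} {c ∷ w} (ρ≤0 ∷ v≤0) (0<c ∷ 0<w) =
      ≤-respʳ-≈ (sym expand) (0≤+0≤
        (0≤*0≤ (inj₁ 0<c) (0≤*0≤ (inj₁ (0<⟨z,z²-ρ⟩ ρ≤0)) (0≤∣∣² P)))
        (0≤*0≤ (0≤∣∣² e) (0≤⟨z*lagrange,∏⟩ v≤0 0<w)))
      where
      e P G : ℂ
      e = z² -ᶜ ρ
      P = evalᶜ (∏ₚ v) z²
      G = evalᶜ (lagrangeₚ v w) z²

      eval-lagrange : evalᶜ (lagrangeₚ (ρ ∷ v) (c ∷ w)) z² ≈ᶜ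
        (c * re P + (re e * re G - im e * im G)) +i (c * im P + (re e * im G + im e * re G))
      eval-lagrange = ℂ-ring.trans (Evalᶜ.eval-+ (c ∙ₚ ∏ₚ v) ((- ρ ∷ 1# ∷ []) *ₚ lagrangeₚ v w) z²)
        (ℂ-ring.+-cong (ℂ-ring.trans (Evalᶜ.eval-∙ c (∏ₚ v) z²)
            ( solve 3 (λ c a b → c :* a :- con (+ 0) :* b := c :* a) refl c (re P) (im P)
            , solve 3 (λ c a b → c :* b :+ con (+ 0) :* a := c :* b) refl c (re P) (im P)))
          (eval-X-ρ* ρ (lagrangeₚ v w)))

      -- The new summand `c P` lacks the factor `e` of the product and leaves `⟨ z , e ⟩`; the old
      -- summands share `e` with the product and leave `∣ e ∣²`.
      expand : ⟨ z *ᶜ evalᶜ (lagrangeₚ (ρ ∷ v) (c ∷ w)) z² , evalᶜ (∏ₚ (ρ ∷ v)) z² ⟩ ≈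
               c * (⟨ z , e ⟩ * ∣ P ∣²) + ∣ e ∣² * ⟨ z *ᶜ G , P ⟩
      expand = trans (⟨⟩-cong (ℂ-ring.*-congˡ {z} eval-lagrange) (eval-X-ρ* ρ (∏ₚ v)))
        (solve 9 (λ s t e₁ e₂ c p₁ p₂ g₁ g₂ →
            (s :* (c :* p₁ :+ (e₁ :* g₁ :- e₂ :* g₂)) :- t :* (c :* p₂ :+ (e₁ :* g₂ :+ e₂ :* g₁))) :* (e₁ :* p₁ :- e₂ :* p₂)
            :+ (s :* (c :* p₂ :+ (e₁ :* g₂ :+ e₂ :* g₁)) :+ t :* (c :* p₁ :+ (e₁ :* g₁ :- e₂ :* g₂))) :* (e₁ :* p₂ :+ e₂ :* p₁)
          := c :* ((s :* e₁ :+ t :* e₂) :* (p₁ :* p₁ :+ p₂ :* p₂))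
            :+ (e₁ :* e₁ :+ e₂ :* e₂) :* ((s :* g₁ :- t :* g₂) :* p₁ :+ (s :* g₂ :+ t :* g₁) :* p₂))
          refl (re z) (im z) (re e) (im e) c (re P) (im P) (re G) (im G))

    -- Pairing the sum with `P` gives `⟨ z G , P ⟩ + ∣ P ∣²`, a nonnegative number plus a positive
    -- one, whereas a vanishing sum would give 0.
    zG+P≉0 : ∀ {n} {v w : Vec Carrier n} → All (_≤ 0#) v → All (0# <_) w →
             ¬ ((z *ᶜ evalᶜ (lagrangeₚ v w) z²) +ᶜ evalᶜ (∏ₚ v) z² ≈ᶜ (0# +i 0#))
    zG+P≉0 {v = v} {w} v≤0 0<w (r≈0 , i≈0) = 0<⇒≉0 (0<+0≤ (0<∣∏∣² v≤0) (0≤⟨z*lagrange,∏⟩ v≤0 0<w))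
      (trans (solve 4 (λ a b p₁ p₂ → p₁ :* p₁ :+ p₂ :* p₂ :+ (a :* p₁ :+ b :* p₂) := (a :+ p₁) :* p₁ :+ (b :+ p₂) :* p₂)
          refl _ _ (re P) (im P))
        (trans (+-cong (*-congʳ r≈0) (*-congʳ i≈0))
          (solve 2 (λ a b → con (+ 0) :* a :+ con (+ 0) :* b := con (+ 0)) refl (re P) (im P))))
      where
      P : ℂ
      P = evalᶜ (∏ₚ v) z²

    zM+M̃≈0 : ∀ n T → IsT n T → IsZeroOf T z → (z *ᶜ evalᶜ (M n) z²) +ᶜ evalᶜ (M̃ n) z² ≈ᶜ (0# +i 0#)
    zM+M̃≈0 n T isT T≈0 = ℂ-ring.trans
      (ℂ-ring.sym (ℂ-ring.trans (Evalᶜ.eval-+ (X *ₚ substSquare (M n)) (substSquare (M̃ n)) z)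
        (ℂ-ring.+-cong (ℂ-ring.trans (Evalᶜ.eval-X* (substSquare (M n)) z)
            (ℂ-ring.*-congˡ {z} (Evalᶜ.eval-substSquare (M n) z)))
          (Evalᶜ.eval-substSquare (M̃ n) z))))
      (ℂ-ring.trans (Evalᶜ.eval-cong (X *ₚ substSquare (M n) +ₚ substSquare (M̃ n)) ((𝟏 +ₚ X) *ₚ T) λ k → sym (isT k))
        (ℂ-ring.trans (Evalᶜ.eval-* (𝟏 +ₚ X) T z) (ℂ-ring.trans
          (ℂ-ring.*-congˡ {evalᶜ (𝟏 +ₚ X) z} {evalᶜ T z} {0# +i 0#} T≈0) (ℂ-ring.zeroʳ (evalᶜ (𝟏 +ₚ X) z)))))

    nonzero : ∀ n T → IsT n T → ¬ IsZeroOf T z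
    -- Order 0 has no nodes; here both polynomials are 1 and the sum is `z + 1`.
    nonzero zero    T isT T≈0 = 0<⇒≉0 (0<+0< 0<re 0<1) (trans
      (sym (trans (+-cong (proj₁ (ℂ-ring.trans (ℂ-ring.*-congˡ {z} (Evalᶜ.eval-𝟏 z²)) (ℂ-ring.*-identityʳ z)))
        (proj₁ (Evalᶜ.eval-𝟏 z²))) refl))
      (proj₁ (zM+M̃≈0 0 T isT T≈0)))
    nonzero (suc m) T isT T≈0 = zG+P≉0 (IsNodes.nonpositive isNodes) (proj₁ (proj₂ weights))
      (ℂ-ring.trans (ℂ-ring.sym (ℂ-ring.+-cong
          (ℂ-ring.*-congˡ {z} (Evalᶜ.eval-cong (M (suc m)) (lagrangeₚ (0# ∷ ρs) (proj₁ weights)) (proj₂ (proj₂ weights))))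
          (Evalᶜ.eval-cong (M̃ (suc m)) (∏ₚ (0# ∷ ρs)) (IsNodes.M̃≈∏ₚ isNodes))))
        (zM+M̃≈0 (suc m) T isT T≈0))
      where
      ρs : Vec Carrier m
      ρs = proj₁ (nodes m)

      isNodes : IsNodes m ρs
      isNodes = proj₂ (nodes m)

      weights : ∃[ w ] All (0# <_) w × M (suc m) ≈ₚ lagrangeₚ (0# ∷ ρs) w
      weights = IsNodes.weights isNodes

  hurwitzStable : ∀ n T → IsT n T → HurwitzStable T
  hurwitzStable n T isT = inj₂ λ z 0<re → nonzero z 0<re n T isT

  -- Interlacing of the two parts of the decomposition.

  lookup-descending : ∀ {n} {v : Vec Carrier n} → Descending v → ∀ i j → toℕ i ℕ.≤ toℕ j → lookup v j ≤ lookup v i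
  lookup-descending (_ ∷ _)    Fin.zero    Fin.zero    _         = inj₂ refl
  lookup-descending (v<ρ ∷ _)  Fin.zero    (Fin.suc j) _         = inj₁ (lookup⁺ v<ρ j)
  lookup-descending (_ ∷ desc) (Fin.suc i) (Fin.suc j) (s≤s i≤j) = lookup-descending desc i j i≤j

  ⋗-lookup : ∀ {n} {v w : Vec Carrier n} → v ⋗ w → ∀ i → lookup w i < lookup v i
  ⋗-lookup ((τ<ρ ∷ _) ∷ _)   Fin.zero    = τ<ρ
  ⋗-lookup (_ ∷ (_ ∷ v⋗w)) (Fin.suc i) = ⋗-lookup v⋗w i

  ⋗-lookup-suc : ∀ {n} {v w : Vec Carrier n} → v ⋗ w → ∀ i j → toℕ j ≡ suc (toℕ i) → lookup v j < lookup w i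
  ⋗-lookup-suc (_ ∷ (v<τ ∷ _))   Fin.zero    (Fin.suc j) _     = lookup⁺ v<τ j
  ⋗-lookup-suc (_ ∷ (_ ∷ v⋗w)) (Fin.suc i) (Fin.suc j) j≡1+i = ⋗-lookup-suc v⋗w i j (ℕ.suc-injective j≡1+i)

  hasZeros : ∀ {d ℓ} f (v : Vec Carrier d) → DegreeAtMost d f → coeff f d ≈ ℓ → 0# < ℓ →
             FactorsOver ℓ (eval f) v → Descending v → HasZeros f (lookup v)
  hasZeros {d} f v f≈0 fd≈ℓ 0<ℓ factors desc =
      ((λ fd≈0 → 0<⇒≉0 0<ℓ (trans (sym fd≈ℓ) fd≈0)) , f≈0)
    , eval-injective f (coeff f d ∙ₚ ∏ₚ v) (λ x → trans (factors x)
        (sym (trans (eval-∙ (coeff f d) (∏ₚ v) x) (*-cong fd≈ℓ (eval-∏ₚ v x)))))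
    , lookup-descending desc

  module _ (m : ℕ) (a b : Poly) (dec : IsDecomposition (suc m) (M̃ (suc m)) a b) where

    private
      ρs : Vec Carrier m
      ρs = proj₁ (nodes m)

      open IsNodes (proj₂ (nodes m))

      v : Vec Carrier (suc m)
      v = 0# ∷ ρs

    eval-M̃ : ∀ x → eval (M̃ (suc m)) x ≈ eval a x + x * eval b x
    eval-M̃ x = trans (eval-cong (M̃ (suc m)) (a +ₚ X *ₚ b) (proj₁ dec))
      (trans (eval-+ a (X *ₚ b) x) (+-congˡ (eval-X* b x)))

    eval-M : ∀ x → eval (M (suc m)) x ≈ eval a x + eval b x
    eval-M x = trans (eval-cong (M (suc m)) (a +ₚ b) (M≈a+b (suc m) a b dec)) (eval-+ a b x)

    -- At the zeros ρ of M̃ = a + x b one has M = a + b = (1 - ρ) b.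
    b-alternating : Alternating (eval b) v
    b-alternating = Alternating-⇛ (All.map (λ { {x} (x≤0 , ∏≈0) → positive-quotient-⇛ (0<1-x x≤0)
        (trans (eval-M x) (trans (solve 3 (λ x a b → a :+ b := (con (+ 1) :- x) :* b :+ (a :+ x :* b)) refl x (eval a x) (eval b x))
          (trans (+-congˡ (trans (sym (eval-M̃ x)) (trans (factored x) ∏≈0))) (+-identityʳ _)))) })
      (All.zip (nonpositive , ∏-zeros v))) alternating

    b-zeros : ∃[ ss ] v ⋗ ss × FactorsOver {m} 1# (eval b) ss
    b-zeros = roots-between (PolyFun-congˡ (b-leading m a b dec) (eval-PolyFun b (b-degree m a b dec)))
      descending b-alternating

    -- At the zeros s of b one has a(s) = M̃(s), and M̃ = x ∏(x - ρ) alternates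
    -- there since the s lie between the zeros of M̃.
    a-zeros : ∀ {k} {ss : Vec Carrier (suc k)} {g} → v ⋗ ss → FactorsOver {suc k} 1# (eval b) ss →
              (∀ x → eval a x ≈ x * g x) → PolyFun k (coeff a m) g → ∃[ rs ] ss ⋗ rs × FactorsOver {k} (coeff a m) g rs
    a-zeros {ss = ss} {g} v⋗ss@(ss<0 ∷ _) b≈ a≈xg G = roots-between G (proj₂ (⋗-descending v⋗ss))
      (Alternating-⇛ (All.map (λ { {x} (x<0 , ∏≈0) → positive-quotient-⇛ (<0⇒0<- x<0)
          (trans (-‿cong (trans (sym (factored x)) (trans (eval-M̃ x)
              (trans (+-cong (a≈xg x) (*-congˡ (trans (b≈ x) (trans (*-congˡ ∏≈0) (zeroʳ 1#)))))
                (trans (+-congˡ (zeroʳ x)) (+-identityʳ _))))))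
            (solve 2 (λ x g → :- (x :* g) := (:- x) :* g) refl x (g x))) })
        (All.zip (ss<0 , ∏-zeros ss))) (proj₂ (⋗-alternating v⋗ss)))

  -- At orders 0 and 1 one part is zero (`b`, then `a`) and the conventions for `≪` decide. From
  -- order 2 on both parts have degree `m` and positive leading coefficients: `a` vanishes at `0#`,
  -- above all zeros of `b`, and between consecutive zeros of `b`, which is the equal-degree case of
  -- `⪯`.
  interlace : ∀ n a b → IsDecomposition n (M̃ n) a b → b ≪ a
  interlace zero a b (M̃≈a+Xb , (a≈0 , _) , b≈0) = inj₂ (inj₂ (inj₁ (b≈0 , 0 , lookup [] ,
      hasZeros {0} {1#} a [] a≈0 a₀≈1 0<1
        (λ x → trans (eval-cong a 𝟏 a≈𝟏) (trans (eval-𝟏 x) (sym (*-identityʳ 1#)))) [])))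
    where
    a₀≈1 : coeff a 0 ≈ 1#
    a₀≈1 = sym (trans (M̃≈a+Xb 0) (trans (coeff-+ a (X *ₚ b) 0) (trans (+-congˡ (coeff-X*-zero b)) (+-identityʳ _))))

    a≈𝟏 : a ≈ₚ 𝟏
    a≈𝟏 zero    = a₀≈1
    a≈𝟏 (suc k) = a≈0 (suc k) (s≤s z≤n)
  interlace (suc zero) a b dec = finish (b-zeros 0 a b dec)
    where
    finish : ∃[ ss ] (0# ∷ proj₁ (nodes 0)) ⋗ ss × FactorsOver {0} 1# (eval b) ss → b ≪ a
    finish ([] , _ , b≈) = inj₂ (inj₂ (inj₂ (a≈𝟎 , 0 , lookup [] ,
        hasZeros {0} {1#} b [] (b-degree 0 a b dec) (b-leading 0 a b dec) 0<1 b≈ [])))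
      where
      a≈𝟎 : a ≈ₚ 𝟎
      a≈𝟎 zero    = a-zero 0 a b dec
      a≈𝟎 (suc k) = a-degree 0 a b dec (suc k) (s≤s z≤n)
  interlace (suc m@(suc k)) a b dec = finish (b-zeros m a b dec)
    where
    0<ℓ : 0# < coeff a m
    0<ℓ = a-leading m a b dec (s≤s z≤n)

    quotient : ∃[ g ] PolyFun k (coeff a m) g × (∀ x → eval a x ≈ eval a 0# + (x - 0#) * g x)
    quotient = factor 0# (eval-PolyFun a (a-degree m a b dec))

    g : Carrier → Carrier
    g = proj₁ quotient

    a≈xg : ∀ x → eval a x ≈ x * g x
    a≈xg x = trans (proj₂ (proj₂ quotient) x) (trans (+-congʳ (trans (eval-at-0 a) (a-zero m a b dec)))
      (solve 2 (λ x y → con (+ 0) :+ (x :- con (+ 0)) :* y := x :* y) refl x (g x)))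

    finish : ∃[ ss ] (0# ∷ proj₁ (nodes m)) ⋗ ss × FactorsOver {m} 1# (eval b) ss → b ≪ a
    finish (ss , v⋗ss@(ss<0 ∷ _) , b≈) =
      let rs , ss⋗rs , g≈ = a-zeros m a b dec v⋗ss b≈ a≈xg (proj₁ (proj₂ quotient))
          r⋗s : (0# ∷ rs) ⋗ ss
          r⋗s = ss<0 ∷ ss⋗rs
          a-hasZeros = hasZeros a (0# ∷ rs) (a-degree m a b dec) refl 0<ℓ (λ x → trans (a≈xg x)
            (trans (*-congˡ (g≈ x)) (solve 3 (λ x l y → x :* (l :* y) := l :* ((x :- con (+ 0)) :* y)) refl
              x (coeff a m) (∏ rs x)))) (proj₁ (⋗-descending r⋗s))
          b-hasZeros = hasZeros b ss (b-degree m a b dec) (b-leading m a b dec) 0<1 b≈ (proj₂ (⋗-descending r⋗s))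
      in inj₁
        ( inj₂ (m , lookup (0# ∷ rs) , lookup ss , a-hasZeros , b-hasZeros
              , (λ i → inj₁ (⋗-lookup r⋗s i)) , (λ i j j≡1+i → inj₁ (⋗-lookup-suc r⋗s i j j≡1+i)))
        , coeff a m , coeff b m , (m , proj₁ a-hasZeros , refl) , (m , proj₁ b-hasZeros , refl)
        , *-pos 0<ℓ (<-respʳ-≈ (sym (b-leading m a b dec)) 0<1))

proposition5p16 : (ℝ : CompleteOrderedField) → let open OverReals ℝ in
    ∀ (n : ℕ) →
    (∃[ T ] IsT n T) ×
    (∀ T → IsT n T → HurwitzStable T) ×
    (∃[ a ] ∃[ b ] IsDecomposition n (M̃ n) a b) ×
    (∀ a b → IsDecomposition n (M̃ n) a b → b ≪ a) ×
    AlternatinglyIncreasing (M n) ×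
    AlternatinglyIncreasing (M̃ n)
proposition5p16 ℝ n =
    (T ℝ n , isT ℝ n)
  , hurwitzStable ℝ n
  , (A ℝ n , B ℝ n , isDecomposition ℝ n)
  , interlace ℝ n
  , M-alternatinglyIncreasing ℝ n
  , M̃-alternatinglyIncreasing ℝ n
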